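{- Let $\mathcal{D}=(D,<,\approx)$, where $D$ is an infinite set, $<$ is a strict total order on $D$, and $\approx$ is equality. Then the satisfiability problems for $\mathrm{LRC}(\mathcal{D})$ and for $\mathrm{LRC}^{\top}(\mathcal{D})$ are undecidable.
   Context: Variables range over a countably infinite set $V$. A model is an infinite sequence $\sigma$ of maps $V\to D$. A formula $\phi$ is satisfiable iff $\sigma,0\models\phi$ for some model $\sigma$. $\mathrm{LRC}^{\top}(\mathcal{D})$ formulas are given by $\phi::= x\approx\mathbf{X}^iy \mid x\approx\mathbf{XF}y \mid x\approx\mathbf{XF}^{ -1}y \mid x<\mathbf{XF}y \mid x>\mathbf{XF}y \mid \phi\wedge\phi\mid\neg\phi\mid\mathbf{X}\phi\mid\phi\mathbf{U}\phi$, with $x,y\in V$ and $i\in\mathbb{N}$. $\mathrm{LRC}(\mathcal{D})$ formulas are given by $\phi::= x\approx\mathbf{X}^iy \mid x\approx\langle\phi?\rangle y \mid x\approx\langle\phi?\rangle^{ -1}y \mid x<\mathbf{XF}y \mid x>\mathbf{XF}y \mid \phi\wedge\phi\mid\neg\phi\mid\mathbf{X}\phi\mid\phi\mathbf{U}\phi\mid\mathbf{X}^{ -1}\phi\mid\phi\mathbf{S}\phi$. Semantics: - $\sigma,i\models x\approx\mathbf{X}^jy$ iff $\sigma(i)(x)=\sigma(i+j)(y)$. - $\sigma,i\models x\approx\mathbf{XF}y$ iff there is $j>i$ with $\sigma(i)(x)=\sigma(j)(y)$. - $\sigma,i\models x\approx\mathbf{XF}^{ -1}y$ iff there is $0\le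 j<i$ with $\sigma(i)(x)=\sigma(j)(y)$. - $\sigma,i\models x<\mathbf{XF}y$ iff there is $j>i$ with $\sigma(i)(x)<\sigma(j)(y)$. - $\sigma,i\models x>\mathbf{XF}y$ iff there is $j>i$ with $\sigma(i)(x)>\sigma(j)(y)$. - $\sigma,i\models x\approx\langle\psi?\rangle y$ iff there is $j>i$ with $\sigma(i)(x)=\sigma(j)(y)$ and $\sigma,j\models\psi$. - $\sigma,i\models x\approx\langle\psi?\rangle^{ -1}y$ iff there is $0\le j<i$ with $\sigma(i)(x)=\sigma(j)(y)$ and $\sigma,j\models\psi$. - Boolean connectives and $\mathbf{X},\mathbf{U}$ are as in LTL. - $\sigma,i\models\mathbf{X}^{ -1}\phi$ iff $i\ge1$ and $\sigma,i-1\models\phi$. - $\sigma,i\models\phi\mathbf{S}\phi'$ iff there is $j\le i$ with $\sigma,j\models\phi'$ and $\sigma,k\models\phi$ for all $j<k\le i$. -}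

module Defs where

open import Data.Bool.Base using (if_then_else_)
open import Data.Fin.Base using (Fin)
open import Data.List.Base using (List; head; drop)
open import Data.Maybe.Base using (Maybe; just; nothing)
open import Data.Nat.Base using (ℕ; zero; suc; pred; _+_; _*_; _^_; _≤_; _<_)
open import Data.Nat.Properties using (_≟_; suc-injective; *-cancelˡ-≡; *-assoc; +-identityʳ; even≢odd)
open import Data.Product.Base using (∃; ∃-syntax; _×_; _,_)
open import Function.Bundles using (_↣_; _↔_; mk↣)
open import Level using (Level)
open import Relation.Binary.Core using (Rel)
open import Relation.Binary.PropositionalEquality using (_≡_; refl; sym; trans; cong; cong₂)
open import Relation.Nullary using (¬_; contradiction)
open import Relation.Nullary.Decidable.Core using (does)

private
  variable
    a ℓ : Level

-- Not in bijection with any Fin n: the weakest constructive form of infinity,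
-- so the weakest hypothesis.
Infinite : Set a → Set a
Infinite D = ¬ (∃[ n ] (D ↔ Fin n))

Var : Set
Var = ℕ

infix  9 _≈X^[_]_ _≈XF_ _≈XF⁻¹_ _≈⟨_?⟩_ _≈⟨_?⟩⁻¹_ _<XF_ _>XF_
infix  8 ∼_ X_ X⁻¹_
infixr 7 _∧_
infixr 6 _U_ _S_

data LRC⊤ : Set where
  _≈X^[_]_ : Var → ℕ → Var → LRC⊤
  _≈XF_    : Var → Var → LRC⊤
  _≈XF⁻¹_  : Var → Var → LRC⊤
  _<XF_    : Var → Var → LRC⊤
  _>XF_    : Var → Var → LRC⊤
  _∧_      : LRC⊤ → LRC⊤ → LRC⊤
  ∼_       : LRC⊤ → LRC⊤
  X_       : LRC⊤ → LRC⊤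
  _U_      : LRC⊤ → LRC⊤ → LRC⊤

data LRC : Set where
  _≈X^[_]_  : Var → ℕ → Var → LRC
  _≈⟨_?⟩_   : Var → LRC → Var → LRC
  _≈⟨_?⟩⁻¹_ : Var → LRC → Var → LRC
  _<XF_     : Var → Var → LRC
  _>XF_     : Var → Var → LRC
  _∧_       : LRC → LRC → LRC
  ∼_        : LRC → LRC
  X_        : LRC → LRC
  _U_       : LRC → LRC → LRC
  X⁻¹_      : LRC → LRC
  _S_       : LRC → LRC → LRC

Model : Set a → Set a
Model D = ℕ → Var → D

-- Equality of data values is _≡_. Lift only equalises universe levels.
module Semantics {D : Set a} (_≺_ : Rel D ℓ) where

  open import Level using (_⊔_; Lift)

  infix 3 _,_⊨⊤_ _,_⊨_

  _,_⊨⊤_ : Model D → ℕ → LRC⊤ → Set (a ⊔ ℓ)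
  σ , i ⊨⊤ x ≈X^[ j ] y = Lift (a ⊔ ℓ) (σ i x ≡ σ (i + j) y)
  σ , i ⊨⊤ x ≈XF y      = Lift (a ⊔ ℓ) (∃[ j ] i < j × σ i x ≡ σ j y)
  σ , i ⊨⊤ x ≈XF⁻¹ y    = Lift (a ⊔ ℓ) (∃[ j ] j < i × σ i x ≡ σ j y)
  σ , i ⊨⊤ x <XF y      = Lift (a ⊔ ℓ) (∃[ j ] i < j × σ i x ≺ σ j y)
  σ , i ⊨⊤ x >XF y      = Lift (a ⊔ ℓ) (∃[ j ] i < j × σ j y ≺ σ i x)
  σ , i ⊨⊤ φ ∧ ψ        = (σ , i ⊨⊤ φ) × (σ , i ⊨⊤ ψ)
  σ , i ⊨⊤ ∼ φ          = ¬ (σ , i ⊨⊤ φ)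
  σ , i ⊨⊤ X φ          = σ , suc i ⊨⊤ φ
  σ , i ⊨⊤ φ U ψ        = ∃[ j ] i ≤ j × (σ , j ⊨⊤ ψ) × (∀ k → i ≤ k → k < j → σ , k ⊨⊤ φ)

  _,_⊨_ : Model D → ℕ → LRC → Set (a ⊔ ℓ)
  σ , i ⊨ x ≈X^[ j ] y    = Lift (a ⊔ ℓ) (σ i x ≡ σ (i + j) y)
  σ , i ⊨ x ≈⟨ ψ ?⟩ y     = ∃[ j ] i < j × σ i x ≡ σ j y × (σ , j ⊨ ψ)
  σ , i ⊨ x ≈⟨ ψ ?⟩⁻¹ y   = ∃[ j ] j < i × σ i x ≡ σ j y × (σ , j ⊨ ψ)
  σ , i ⊨ x <XF y         = Lift (a ⊔ ℓ) (∃[ j ] i < j × σ i x ≺ σ j y)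
  σ , i ⊨ x >XF y         = Lift (a ⊔ ℓ) (∃[ j ] i < j × σ j y ≺ σ i x)
  σ , i ⊨ φ ∧ ψ           = (σ , i ⊨ φ) × (σ , i ⊨ ψ)
  σ , i ⊨ ∼ φ             = ¬ (σ , i ⊨ φ)
  σ , i ⊨ X φ             = σ , suc i ⊨ φ
  σ , i ⊨ φ U ψ           = ∃[ j ] i ≤ j × (σ , j ⊨ ψ) × (∀ k → i ≤ k → k < j → σ , k ⊨ φ)
  σ , i ⊨ X⁻¹ φ           = 1 ≤ i × (σ , pred i ⊨ φ)
  σ , i ⊨ φ S ψ           = ∃[ j ] j ≤ i × (σ , j ⊨ ψ) × (∀ k → j < k → k ≤ i → σ , k ⊨ φ)

  Satisfiable⊤ : LRC⊤ → Set (a ⊔ ℓ)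
  Satisfiable⊤ φ = ∃[ σ ] (σ , 0 ⊨⊤ φ)

  Satisfiable : LRC → Set (a ⊔ ℓ)
  Satisfiable φ = ∃[ σ ] (σ , 0 ⊨ φ)

open Semantics public

Registers : Set
Registers = ℕ → ℕ

infixl 6 _[_≔_]
_[_≔_] : Registers → ℕ → ℕ → Registers
(ρ [ r ≔ v ]) s = if does (s ≟ r) then v else ρ s

-- Minsky machines with unboundedly many registers.
-- dec r l jumps to l when register r is zero; otherwise it decrements r and
-- falls through to the next instruction.
data Instr : Set where
  inc : (r : ℕ) → Instr
  dec : (r l : ℕ) → Instr

Machine : Set
Machine = List Instr

Config : Set
Config = ℕ × Registers

exec : Instr → Config → Config
exec (inc r)   (pc , ρ) = suc pc , ρ [ r ≔ suc (ρ r) ]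
exec (dec r l) (pc , ρ) with ρ r
... | zero  = l , ρ
... | suc v = suc pc , ρ [ r ≔ v ]

fetch : Machine → ℕ → Maybe Instr
fetch M pc = head (drop pc M)

-- A machine halts when its program counter leaves the program.
infix 3 _⊢_⇓_
data _⊢_⇓_ (M : Machine) : Config → Registers → Set where
  halt : ∀ {pc ρ} → fetch M pc ≡ nothing → M ⊢ pc , ρ ⇓ ρ
  step : ∀ {pc ρ ρ′ I} → fetch M pc ≡ just I → M ⊢ exec I (pc , ρ) ⇓ ρ′ → M ⊢ pc , ρ ⇓ ρ′

-- Input and output are in register 0; all other registers are initially 0.
Computes : Machine → ℕ → ℕ → Set
Computes M n m = ∃[ ρ ] (M ⊢ 0 , ((λ _ → 0) [ 0 ≔ n ]) ⇓ ρ) × ρ 0 ≡ m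

-- M computes the characteristic function of P, relative to a numbering of A.
-- Phrased without Dec (P x), which P need not have constructively.
Decides : {A : Set} → (A → ℕ) → Machine → (A → Set ℓ) → Set ℓ
Decides code M P = ∀ x → (P x → Computes M (code x) 1) × (¬ P x → Computes M (code x) 0)

-- Only meaningful for an effective numbering, such as gödel and gödel⊤ below.
Undecidable : {A : Set} → A ↣ ℕ → (A → Set ℓ) → Set ℓ
Undecidable numbering P = ¬ (∃[ M ] Decides to M P)
  where open Function.Bundles.Injection numbering using (to)

pair : ℕ → ℕ → ℕ
pair m n = 2 ^ m * suc (2 * n)

pair-injective : ∀ m m′ {n n′} → pair m n ≡ pair m′ n′ → m ≡ m′ × n ≡ n′
pair-injective zero zero {n} {n′} eq =
  refl , *-cancelˡ-≡ n n′ 2 (suc-injective (trans (sym (+-identityʳ _)) (trans eq (+-identityʳ _))))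
pair-injective zero (suc m′) {n} {n′} eq =
  contradiction (trans (sym (*-assoc 2 (2 ^ m′) _)) (trans (sym eq) (+-identityʳ _)))
                (even≢odd (pair m′ n′) n)
pair-injective (suc m) zero {n} {n′} eq =
  contradiction (trans (sym (*-assoc 2 (2 ^ m) _)) (trans eq (+-identityʳ _)))
                (even≢odd (pair m n) n′)
pair-injective (suc m) (suc m′) eq
  with pair-injective m m′ (*-cancelˡ-≡ _ _ 2
         (trans (sym (*-assoc 2 (2 ^ m) _)) (trans eq (*-assoc 2 (2 ^ m′) _))))
... | refl , n≡n′ = refl , n≡n′

data Tree : Set where
  leaf : ℕ → Tree
  node : Tree → Tree → Tree

codeTree : Tree → ℕ
codeTree (leaf n)   = pair 0 n
codeTree (node s t) = pair (suc (codeTree s)) (codeTree t)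

codeTree-injective : ∀ s t → codeTree s ≡ codeTree t → s ≡ t
codeTree-injective (leaf m) (leaf n) eq with pair-injective 0 0 eq
... | _ , m≡n = cong leaf m≡n
codeTree-injective (leaf m) (node t t′) eq with pair-injective 0 (suc (codeTree t)) {m} {codeTree t′} eq
... | () , _
codeTree-injective (node s s′) (leaf n) eq with pair-injective (suc (codeTree s)) 0 {codeTree s′} {n} eq
... | () , _
codeTree-injective (node s s′) (node t t′) eq
  with pair-injective (suc (codeTree s)) (suc (codeTree t)) eq
... | p , q = cong₂ node (codeTree-injective s t (suc-injective p)) (codeTree-injective s′ t′ q)

tree⊤ : LRC⊤ → Tree
tree⊤ (x ≈X^[ i ] y) = node (leaf 0) (node (leaf x) (node (leaf i) (leaf y)))
tree⊤ (x ≈XF y)      = node (leaf 1) (node (leaf x) (leaf y))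
tree⊤ (x ≈XF⁻¹ y)    = node (leaf 2) (node (leaf x) (leaf y))
tree⊤ (x <XF y)      = node (leaf 3) (node (leaf x) (leaf y))
tree⊤ (x >XF y)      = node (leaf 4) (node (leaf x) (leaf y))
tree⊤ (φ ∧ ψ)        = node (leaf 5) (node (tree⊤ φ) (tree⊤ ψ))
tree⊤ (∼ φ)          = node (leaf 6) (tree⊤ φ)
tree⊤ (X φ)          = node (leaf 7) (tree⊤ φ)
tree⊤ (φ U ψ)        = node (leaf 8) (node (tree⊤ φ) (tree⊤ ψ))

tree : LRC → Tree
tree (x ≈X^[ i ] y)   = node (leaf 0) (node (leaf x) (node (leaf i) (leaf y)))
tree (x ≈⟨ φ ?⟩ y)    = node (leaf 1) (node (leaf x) (node (tree φ) (leaf y)))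
tree (x ≈⟨ φ ?⟩⁻¹ y)  = node (leaf 2) (node (leaf x) (node (tree φ) (leaf y)))
tree (x <XF y)        = node (leaf 3) (node (leaf x) (leaf y))
tree (x >XF y)        = node (leaf 4) (node (leaf x) (leaf y))
tree (φ ∧ ψ)          = node (leaf 5) (node (tree φ) (tree ψ))
tree (∼ φ)            = node (leaf 6) (tree φ)
tree (X φ)            = node (leaf 7) (tree φ)
tree (φ U ψ)          = node (leaf 8) (node (tree φ) (tree ψ))
tree (X⁻¹ φ)          = node (leaf 9) (tree φ)
tree (φ S ψ)          = node (leaf 10) (node (tree φ) (tree ψ))

-- Left inverses of tree⊤ and tree; the value on other trees is irrelevant.
untree⊤ : Tree → LRC⊤
untree⊤ (node (leaf 0) (node (leaf x) (node (leaf i) (leaf y)))) = x ≈X^[ i ] y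
untree⊤ (node (leaf 1) (node (leaf x) (leaf y))) = x ≈XF y
untree⊤ (node (leaf 2) (node (leaf x) (leaf y))) = x ≈XF⁻¹ y
untree⊤ (node (leaf 3) (node (leaf x) (leaf y))) = x <XF y
untree⊤ (node (leaf 4) (node (leaf x) (leaf y))) = x >XF y
untree⊤ (node (leaf 5) (node s t)) = untree⊤ s ∧ untree⊤ t
untree⊤ (node (leaf 6) t) = ∼ untree⊤ t
untree⊤ (node (leaf 7) t) = X untree⊤ t
untree⊤ (node (leaf 8) (node s t)) = untree⊤ s U untree⊤ t
untree⊤ _ = 0 ≈XF 0

untree : Tree → LRC
untree (node (leaf 0) (node (leaf x) (node (leaf i) (leaf y)))) = x ≈X^[ i ] y
untree (node (leaf 1) (node (leaf x) (node t (leaf y)))) = x ≈⟨ untree t ?⟩ y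
untree (node (leaf 2) (node (leaf x) (node t (leaf y)))) = x ≈⟨ untree t ?⟩⁻¹ y
untree (node (leaf 3) (node (leaf x) (leaf y))) = x <XF y
untree (node (leaf 4) (node (leaf x) (leaf y))) = x >XF y
untree (node (leaf 5) (node s t)) = untree s ∧ untree t
untree (node (leaf 6) t) = ∼ untree t
untree (node (leaf 7) t) = X untree t
untree (node (leaf 8) (node s t)) = untree s U untree t
untree (node (leaf 9) t) = X⁻¹ untree t
untree (node (leaf 10) (node s t)) = untree s S untree t
untree _ = 0 <XF 0

untree⊤-tree⊤ : ∀ φ → untree⊤ (tree⊤ φ) ≡ φ
untree⊤-tree⊤ (x ≈X^[ i ] y) = refl
untree⊤-tree⊤ (x ≈XF y)      = refl
untree⊤-tree⊤ (x ≈XF⁻¹ y)    = refl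
untree⊤-tree⊤ (x <XF y)      = refl
untree⊤-tree⊤ (x >XF y)      = refl
untree⊤-tree⊤ (φ ∧ ψ)        = cong₂ _∧_ (untree⊤-tree⊤ φ) (untree⊤-tree⊤ ψ)
untree⊤-tree⊤ (∼ φ)          = cong ∼_ (untree⊤-tree⊤ φ)
untree⊤-tree⊤ (X φ)          = cong X_ (untree⊤-tree⊤ φ)
untree⊤-tree⊤ (φ U ψ)        = cong₂ _U_ (untree⊤-tree⊤ φ) (untree⊤-tree⊤ ψ)

untree-tree : ∀ φ → untree (tree φ) ≡ φ
untree-tree (x ≈X^[ i ] y)  = refl
untree-tree (x ≈⟨ φ ?⟩ y)   = cong (x ≈⟨_?⟩ y) (untree-tree φ)
untree-tree (x ≈⟨ φ ?⟩⁻¹ y) = cong (x ≈⟨_?⟩⁻¹ y) (untree-tree φ)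
untree-tree (x <XF y)       = refl
untree-tree (x >XF y)       = refl
untree-tree (φ ∧ ψ)         = cong₂ _∧_ (untree-tree φ) (untree-tree ψ)
untree-tree (∼ φ)           = cong ∼_ (untree-tree φ)
untree-tree (X φ)           = cong X_ (untree-tree φ)
untree-tree (φ U ψ)         = cong₂ _U_ (untree-tree φ) (untree-tree ψ)
untree-tree (X⁻¹ φ)         = cong X⁻¹_ (untree-tree φ)
untree-tree (φ S ψ)         = cong₂ _S_ (untree-tree φ) (untree-tree ψ)

gödel⊤ : LRC⊤ ↣ ℕ
gödel⊤ = mk↣ {to = λ φ → codeTree (tree⊤ φ)} λ {φ} {ψ} eq →
  trans (sym (untree⊤-tree⊤ φ))
        (trans (cong untree⊤ (codeTree-injective _ _ eq)) (untree⊤-tree⊤ ψ))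

gödel : LRC ↣ ℕ
gödel = mk↣ {to = λ φ → codeTree (tree φ)} λ {φ} {ψ} eq →
  trans (sym (untree-tree φ))
        (trans (cong untree (codeTree-injective _ _ eq)) (untree-tree ψ))

{-# OPTIONS --safe #-}

-- A machine Q gets a formula θ such that θ ∧ ref ≈X^[ n ] mark is satisfiable iff Q halts on n.
-- A counter is the number of changes of a variable x minus that of a variable y. The order
-- constraints make both nondecreasing, and with ≈XF and ≈XF⁻¹ they force y to run through exactly
-- the values of x in the same order, so the counter is zero iff x and y are equal: a zero test.
-- A halting run needs only a finite ascending chain of data values, and such chains exist (up to
-- double negation) in every infinite D.
--
-- Since n is a single leaf of the formula, no coding of machines is needed for the diagonal
-- argument: given a decision procedure M, let Q map n to the code of t ∧ ref ≈X^[ n ] mark, where t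
-- has code n, run M on it, and halt iff M answers 0. Run Q on the code of its own θ.
module Submission where

open import Defs
open import Data.Bool.Base using (Bool; true; false; if_then_else_; T)
open import Data.Empty using (⊥)
open import Data.Fin.Base as Fin using (Fin; toℕ)
open import Data.Fin.Patterns using (0F; 1F; 2F; 3F)
open import Data.List.Base as List using (List; []; _∷_; _++_; length; map)
open import Data.List.Membership.Propositional using (_∈_; _∉_)
open import Data.List.Membership.Propositional.Properties using (∈-lookup)
open import Data.List.Properties using (length-map; length-++)
open import Data.List.Relation.Unary.All as All using (All; []; _∷_)
open import Data.List.Relation.Unary.AllPairs.Core using (AllPairs; []; _∷_)
open import Data.List.Relation.Unary.Any as Any using (here; there; index)
open import Data.List.Relation.Unary.Any.Properties using (lookup-index)
open import Data.Maybe.Base using (Maybe; just; nothing)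
open import Data.Nat.Base hiding (compare)
open import Data.Nat.Properties
open import Data.Product.Base using (∃; ∃-syntax; _×_; _,_; proj₁; proj₂)
open import Data.Sum.Base using (inj₁; inj₂)
open import Data.Vec.Base as Vec using (Vec; []; _∷_; lookup; _[_]≔_)
open import Function.Base using (_∘_)
open import Function.Bundles using (mk↔ₛ′)
open import Level using (lift; lower)
open import Relation.Binary.Core using (Rel)
open import Relation.Binary.Definitions using (tri<; tri≈; tri>)
open import Relation.Binary.PropositionalEquality
open import Relation.Binary.Structures using (IsStrictTotalOrder)
open import Relation.Nullary using (¬_; Dec; yes; no; contradiction)
open import Relation.Nullary.Decidable using (dec-true; dec-false; decidable-stable)

-- Runs of Minsky machines and equivalence of halting

private
  variable
    M : Machine
    pc o : ℕ
    ρ ρ′ : Registers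

update-cong : ∀ r {v v′} → v ≡ v′ → ρ ≗ ρ′ → ρ [ r ≔ v ] ≗ ρ′ [ r ≔ v′ ]
update-cong r refl ρ≗ρ′ s with s ≡ᵇ r
... | true  = refl
... | false = ρ≗ρ′ s

exec-dec-zero : ∀ {r l} → ρ r ≡ 0 → exec (dec r l) (pc , ρ) ≡ (l , ρ)
exec-dec-zero eq rewrite eq = refl

exec-dec-suc : ∀ {r l v} → ρ r ≡ suc v → exec (dec r l) (pc , ρ) ≡ (suc pc , ρ [ r ≔ v ])
exec-dec-suc eq rewrite eq = refl

Halts : Machine → Config → Set
Halts M c = ∃ (M ⊢ c ⇓_)

-- Pointwise equal registers need not be propositionally equal, so only the existence of a halting
-- run is carried over, not its final registers.
⇓-cong : M ⊢ pc , ρ ⇓ ρ′ → ∀ {ρ₁} → ρ ≗ ρ₁ → Halts M (pc , ρ₁)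
⇓-cong (halt f) _ = _ , halt f
⇓-cong (step {I = inc r} f d) ρ≗ρ₁ with ⇓-cong d (update-cong r (cong suc (ρ≗ρ₁ r)) ρ≗ρ₁)
... | _ , d₁ = _ , step f d₁
⇓-cong {M = M} {ρ = ρ} (step {I = dec r l} f d) {ρ₁} ρ≗ρ₁ with ρ r in eq
... | zero with ⇓-cong d ρ≗ρ₁
...   | ρ′ , d₁ = ρ′ , step f (subst (M ⊢_⇓ ρ′) (sym (exec-dec-zero (trans (sym (ρ≗ρ₁ r)) eq))) d₁)
⇓-cong {M = M} (step {I = dec r l} f d) {ρ₁} ρ≗ρ₁ | suc v with ⇓-cong d (update-cong r refl ρ≗ρ₁)
...   | ρ′ , d₁ = ρ′ , step f (subst (M ⊢_⇓ ρ′) (sym (exec-dec-suc {ρ₁} (trans (sym (ρ≗ρ₁ r)) eq))) d₁)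

infix 3 _⊢_≋_
-- Both directions are used: one shows that the diagonal machine halts, the other that it diverges.
-- Comparing halting rather than reachability also absorbs pointwise equality of registers.
_⊢_≋_ : Machine → Config → Config → Set
M ⊢ c ≋ c′ = (Halts M c → Halts M c′) × (Halts M c′ → Halts M c)

≋-trans : ∀ {c d e} → M ⊢ c ≋ d → M ⊢ d ≋ e → M ⊢ c ≋ e
≋-trans (f , f′) (g , g′) = g ∘ f , f′ ∘ g′

≋-cong : ρ ≗ ρ′ → M ⊢ pc , ρ ≋ pc , ρ′
≋-cong eq = (λ (_ , d) → ⇓-cong d eq) , (λ (_ , d) → ⇓-cong d (sym ∘ eq))

≋-step : ∀ {c d I} → fetch M (proj₁ c) ≡ just I → exec I c ≡ d → M ⊢ c ≋ d
≋-step {M} {c} {I = I} f refl = (λ (_ , d) → forward d) , λ (_ , d) → _ , step f d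
  where
  forward : ∀ {ρ} → M ⊢ c ⇓ ρ → Halts M (exec I c)
  forward (halt f′) with () ← trans (sym f) f′
  forward (step f′ d) with refl ← trans (sym f) f′ = _ , d

-- A derivation from this configuration would contain a strictly smaller one from the same
-- configuration, so induction on derivations refutes it.
self-loop : ∀ {r} → fetch M pc ≡ just (dec r pc) → ρ r ≡ 0 → ¬ Halts M (pc , ρ)
self-loop {M = M} {pc} {ρ} {r} f ρr≡0 (_ , d) = diverges d refl
  where
  diverges : ∀ {c ρ′} → M ⊢ c ⇓ ρ′ → c ≢ (pc , ρ)
  diverges (halt f′) refl with () ← trans (sym f) f′
  diverges (step f′ d) refl with refl ← trans (sym f) f′ = diverges d (exec-dec-zero ρr≡0)

-- Code fragments and relocation

fetch-[] : ∀ k → fetch [] k ≡ nothing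
fetch-[] zero    = refl
fetch-[] (suc k) = refl

fetch-just⇒< : ∀ M k {I} → fetch M k ≡ just I → k < length M
fetch-just⇒< [] k f with () ← trans (sym f) (fetch-[] k)
fetch-just⇒< (_ ∷ M) zero    f = z<s
fetch-just⇒< (_ ∷ M) (suc k) f = s<s (fetch-just⇒< M k f)

fetch-nothing⇒≥ : ∀ M k → fetch M k ≡ nothing → length M ≤ k
fetch-nothing⇒≥ []      k       f = z≤n
fetch-nothing⇒≥ (_ ∷ M) (suc k) f = s≤s (fetch-nothing⇒≥ M k f)

≥⇒fetch-nothing : ∀ M k → length M ≤ k → fetch M k ≡ nothing
≥⇒fetch-nothing []      k       _         = fetch-[] k
≥⇒fetch-nothing (_ ∷ M) (suc k) (s≤s l≤k) = ≥⇒fetch-nothing M k l≤k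

fetch-++ˡ : ∀ M N k {I} → fetch M k ≡ just I → fetch (M ++ N) k ≡ just I
fetch-++ˡ [] N k f with () ← trans (sym f) (fetch-[] k)
fetch-++ˡ (_ ∷ M) N zero    f = f
fetch-++ˡ (_ ∷ M) N (suc k) f = fetch-++ˡ M N k f

fetch-++ʳ : ∀ M N k → fetch (M ++ N) (length M + k) ≡ fetch N k
fetch-++ʳ []      N k = refl
fetch-++ʳ (_ ∷ M) N k = fetch-++ʳ M N k

fetch-map : ∀ (f : Instr → Instr) M k {I} → fetch M k ≡ just I → fetch (map f M) k ≡ just (f I)
fetch-map f []      k  eq with () ← trans (sym eq) (fetch-[] k)
fetch-map f (_ ∷ M) zero    refl = refl
fetch-map f (_ ∷ M) (suc k) eq   = fetch-map f M k eq

record Loaded (M : Machine) (o : ℕ) (N : List Instr) : Set where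
  constructor loaded
  field fetches : ∀ k {I} → fetch N k ≡ just I → fetch M (o + k) ≡ just I

open Loaded

Loaded-++ˡ : ∀ {N} N′ → Loaded M o (N ++ N′) → Loaded M o N
Loaded-++ˡ {N = N} N′ ld .fetches k f = fetches ld k (fetch-++ˡ N N′ k f)

Loaded-++ʳ : ∀ N {N′} → Loaded M o (N ++ N′) → Loaded M (o + length N) N′
Loaded-++ʳ {o = o} N {N′} ld .fetches k f rewrite +-assoc o (length N) k =
  fetches ld (length N + k) (trans (fetch-++ʳ N N′ k) f)

Loaded-head : ∀ {I N} → Loaded M o (I ∷ N) → fetch M o ≡ just I
Loaded-head {M = M} {o} {I} ld = subst (λ a → fetch M a ≡ just I) (+-identityʳ o) (fetches ld 0 refl)

Loaded-tail : ∀ {I N} → Loaded M o (I ∷ N) → Loaded M (suc o) N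
Loaded-tail {M = M} {o} ld .fetches k {J} f =
  subst (λ a → fetch M a ≡ just J) (+-suc o k) (fetches ld (suc k) f)

-- Jumps out of M are redirected to the first address after the relocated copy.
relocate : ℕ → ℕ → Instr → Instr
relocate o len (inc r)   = inc r
relocate o len (dec r l) = dec r (o + (l ⊓ len))

-- `pc ⊓ length M` collapses all halting addresses, including targets far beyond the end of `M`, to
-- the first address after the copy; inside `M` it is `pc` itself.
relocate-run : ∀ {Q} → Loaded Q o (map (relocate o (length M)) M) → M ⊢ pc , ρ ⇓ ρ′ →
  Q ⊢ o + (pc ⊓ length M) , ρ ≋ o + length M , ρ′
relocate-run {o} {M} {Q = Q} ld (halt {pc} {ρ} f) =
  subst (λ k → Q ⊢ o + k , ρ ≋ o + length M , ρ)
    (sym (m≥n⇒m⊓n≡n (fetch-nothing⇒≥ M pc f))) ((λ h → h) , (λ h → h))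
relocate-run {o} {M} {Q = Q} ld (step {pc} {ρ} {ρ′} {I} f d) =
  ≋-trans (≋-step f′ refl) (go I d)
  where
  len = length M
  pc<len = fetch-just⇒< M pc f
  pc⊓ : pc ⊓ len ≡ pc
  pc⊓ = m≤n⇒m⊓n≡m (<⇒≤ pc<len)
  next : suc (o + (pc ⊓ len)) ≡ o + (suc pc ⊓ len)
  next = trans (cong (λ k → suc (o + k)) pc⊓)
    (trans (sym (+-suc o pc)) (cong (o +_) (sym (m≤n⇒m⊓n≡m pc<len))))
  f′ : fetch Q (o + (pc ⊓ len)) ≡ just (relocate o len I)
  f′ = subst (λ k → fetch Q (o + k) ≡ _) (sym pc⊓) (fetches ld pc (fetch-map _ M pc f))
  go : ∀ I → M ⊢ exec I (pc , ρ) ⇓ ρ′ →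
    Q ⊢ exec (relocate o len I) (o + (pc ⊓ len) , ρ) ≋ o + len , ρ′
  go (inc r) d rewrite next = relocate-run ld d
  go (dec r l) d with ρ r
  ... | zero = relocate-run ld d
  ... | suc v rewrite next = relocate-run ld d

-- A loop language and its compilation

data Cmd (K : ℕ) : Set where
  skip : Cmd K
  inc  : Fin K → Cmd K
  _⨾_  : Cmd K → Cmd K → Cmd K
  loop : Fin K → Cmd K → Cmd K

infixr 5 _⨾_

private
  variable
    K : ℕ

-- A relation rather than a function, since a loop body may refill its own register and never
-- finish.
data Run {K} : Cmd K → Vec ℕ K → Vec ℕ K → Set where
  skip : ∀ {v} → Run skip v v
  inc  : ∀ {r v} → Run (inc r) v (v [ r ]≔ suc (lookup v r))
  _⨾_  : ∀ {c d v v′ v″} → Run c v v′ → Run d v′ v″ → Run (c ⨾ d) v v″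
  done : ∀ {r c v} → lookup v r ≡ 0 → Run (loop r c) v v
  iter : ∀ {r c v v′ v″ k} → lookup v r ≡ suc k → Run c (v [ r ]≔ k) v′ →
         Run (loop r c) v′ v″ → Run (loop r c) v v″

size : Cmd K → ℕ
size skip       = 0
size (inc r)    = 1
size (c ⨾ d)    = size c + size d
size (loop r c) = suc (size c + 1)

-- Register K is never modified, so dec K o is an unconditional jump.
compile : ℕ → Cmd K → List Instr
compile o skip       = []
compile o (inc r)    = inc (toℕ r) ∷ []
compile o (c ⨾ d)    = compile o c ++ compile (o + size c) d
compile {K} o (loop r c) =
  dec (toℕ r) (o + size (loop r c)) ∷ compile (suc o) c ++ dec K o ∷ []

length-compile : ∀ o (c : Cmd K) → length (compile o c) ≡ size c
length-compile o skip       = refl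
length-compile o (inc r)    = refl
length-compile o (c ⨾ d)    = trans (length-++ (compile o c))
  (cong₂ _+_ (length-compile o c) (length-compile (o + size c) d))
length-compile o (loop r c) = cong suc (trans (length-++ (compile (suc o) c))
  (cong (_+ 1) (length-compile (suc o) c)))

registers : Vec ℕ K → Registers
registers []      s       = 0
registers (a ∷ v) zero    = a
registers (a ∷ v) (suc s) = registers v s

registers-lookup : ∀ (v : Vec ℕ K) r → registers v (toℕ r) ≡ lookup v r
registers-lookup (a ∷ v) 0F          = refl
registers-lookup (a ∷ v) (Fin.suc r) = registers-lookup v r

registers-end : ∀ (v : Vec ℕ K) → registers v K ≡ 0
registers-end []      = refl
registers-end (a ∷ v) = registers-end v

registers-update : ∀ (v : Vec ℕ K) r a → registers v [ toℕ r ≔ a ] ≗ registers (v [ r ]≔ a)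
registers-update (b ∷ v) 0F          a zero    = refl
registers-update (b ∷ v) 0F          a (suc s) = refl
registers-update (b ∷ v) (Fin.suc r) a zero    = refl
registers-update (b ∷ v) (Fin.suc r) a (suc s) = registers-update v r a s

compile-run : ∀ {K o} {c : Cmd K} {v v′ Q} → Loaded Q o (compile o c) → Run c v v′ →
  Q ⊢ o , registers v ≋ o + size c , registers v′
compile-run {o = o} {Q = Q} ld skip rewrite +-identityʳ o = (λ h → h) , (λ h → h)
compile-run {o = o} {Q = Q} ld (inc {r} {v}) rewrite +-comm o 1 =
  ≋-trans (≋-step (Loaded-head ld) refl)
    (≋-cong λ s → trans
      (update-cong {registers v} (toℕ r) (cong suc (registers-lookup v r)) (λ _ → refl) s)
      (registers-update v r _ s))
compile-run {o = o} {Q = Q} ld (_⨾_ {c} {d} {v} {v′} {v″} x y) =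
  ≋-trans (compile-run (Loaded-++ˡ _ ld) x)
    (subst (λ a → Q ⊢ o + size c , registers v′ ≋ a , registers v″) (+-assoc o (size c) (size d))
      (compile-run (subst (λ k → Loaded Q (o + k) (compile (o + size c) d)) (length-compile o c)
        (Loaded-++ʳ (compile o c) ld)) y))
compile-run ld (done {r} {v = v} eq) =
  ≋-step (Loaded-head ld) (exec-dec-zero (trans (registers-lookup v r) eq))
compile-run {K = K} {o = o} {Q = Q} ld (iter {r} {c} {v} {v′} {k = k} eq x y) =
  ≋-trans (≋-step (Loaded-head ld) (exec-dec-suc (trans (registers-lookup v r) eq)))
  (≋-trans (≋-cong (registers-update v r k))
  (≋-trans (compile-run (Loaded-++ˡ _ (Loaded-tail ld)) x)
  (≋-trans (≋-step back (exec-dec-zero (registers-end v′)))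
           (compile-run ld y))))
  where
  back : fetch Q (suc o + size c) ≡ just (dec K o)
  back = Loaded-head (subst (λ k → Loaded Q (suc o + k) _) (length-compile (suc o) c)
    (Loaded-++ʳ (compile (suc o) c) (Loaded-tail ld)))

-- The diagonal machine

initial : ℕ → Config
initial n = 0 , (λ _ → 0) [ 0 ≔ n ]

registers-zeros : ∀ K s → registers (Vec.replicate K 0) s ≡ 0
registers-zeros zero    s       = refl
registers-zeros (suc K) zero    = refl
registers-zeros (suc K) (suc s) = registers-zeros K s

module _ {K : ℕ} (prog : Cmd (suc K)) (M : Machine) where
  private
    base = size prog
    end = base + length M
    body = map (relocate base (length M)) M

    epilogue : List Instr
    epilogue = dec 0 (2 + end) ∷ dec 0 (1 + end) ∷ []

  -- The epilogue halts if M outputs 0 and diverges if it outputs 1.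
  contrarian : Machine
  contrarian = compile 0 prog ++ body ++ epilogue

  module _ {g : ℕ → ℕ}
    (computes-g : ∀ n → Run prog (n ∷ Vec.replicate K 0) (g n ∷ Vec.replicate K 0)) where

    private
      loaded-all : Loaded contrarian 0 contrarian
      loaded-all = loaded λ k f → f

      loaded-rest : Loaded contrarian base (body ++ epilogue)
      loaded-rest = subst (λ k → Loaded contrarian k (body ++ epilogue)) (length-compile 0 prog)
        (Loaded-++ʳ (compile 0 prog) loaded-all)

      loaded-epilogue : Loaded contrarian end epilogue
      loaded-epilogue = subst (λ k → Loaded contrarian (base + k) epilogue)
        (length-map (relocate base (length M)) M) (Loaded-++ʳ body loaded-rest)

      length-contrarian : length contrarian ≡ 2 + end
      length-contrarian = begin
        length contrarian                                ≡⟨ length-++ (compile 0 prog) ⟩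
        length (compile 0 prog) + length (body ++ epilogue)
          ≡⟨ cong₂ _+_ (length-compile 0 prog) (length-++ body) ⟩
        base + (length body + 2)
          ≡⟨ cong (λ k → base + (k + 2)) (length-map (relocate base (length M)) M) ⟩
        base + (length M + 2)                            ≡⟨ +-assoc base (length M) 2 ⟨
        end + 2                                          ≡⟨ +-comm end 2 ⟩
        2 + end                                          ∎
        where open ≡-Reasoning

      initial≗ : ∀ n → (λ _ → 0) [ 0 ≔ n ] ≗ registers (n ∷ Vec.replicate K 0)
      initial≗ n zero    = refl
      initial≗ n (suc s) = sym (registers-zeros K s)

      -- `prog` leaves every register except 0 at zero, so the relocated `M` starts, up to pointwise
      -- equality, with the registers of its initial configuration on `g n`.
      reaches-epilogue : ∀ n {ρ} → M ⊢ initial (g n) ⇓ ρ → contrarian ⊢ initial n ≋ end , ρ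
      reaches-epilogue n {ρ} d =
        ≋-trans (≋-cong (initial≗ n))
        (≋-trans (compile-run (Loaded-++ˡ (body ++ epilogue) loaded-all) (computes-g n))
        (≋-trans (≋-cong (sym ∘ initial≗ (g n)))
        (subst (λ a → contrarian ⊢ a , (λ _ → 0) [ 0 ≔ g n ] ≋ end , ρ) (+-identityʳ base)
          (relocate-run (Loaded-++ˡ epilogue loaded-rest) d))))

    contrarian-halts : ∀ n → Computes M (g n) 0 → Halts contrarian (initial n)
    contrarian-halts n (ρ , d , ρ0≡0) = proj₂ (reaches-epilogue n d)
      (proj₂ (≋-step (Loaded-head loaded-epilogue) (exec-dec-zero {ρ} ρ0≡0))
        (ρ , halt (≥⇒fetch-nothing contrarian (2 + end) (≤-reflexive length-contrarian))))

    -- The first `dec` of the epilogue lowers register 0 from 1 to 0; the second one then jumps to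
    -- its own address forever.
    contrarian-diverges : ∀ n → Computes M (g n) 1 → ¬ Halts contrarian (initial n)
    contrarian-diverges n (ρ , d , ρ0≡1) h =
      self-loop {ρ = ρ [ 0 ≔ 0 ]} (Loaded-head (Loaded-tail loaded-epilogue)) refl
        (proj₁ (≋-step (Loaded-head loaded-epilogue) (exec-dec-suc {ρ} ρ0≡1))
          (proj₁ (reaches-epilogue n d) h))

-- If `P φ` held, `M` would answer 1 and `Q` would diverge on `n`, against soundness. So `P φ`
-- fails, `M` answers 0 and `Q` halts on `n`, against completeness. Both contradictions are proofs
-- of the empty type, which is why soundness and completeness are only required up to double
-- negation.
diagonalisation : ∀ {ℓ K} {A : Set} (code : A → ℕ) (P : A → Set ℓ)
  (θ : Machine → A) (apply : A → ℕ → A) (prog : Cmd (suc K)) (g : ℕ → ℕ) →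
  (∀ n → Run prog (n ∷ Vec.replicate K 0) (g n ∷ Vec.replicate K 0)) →
  (∀ φ → code (apply φ (code φ)) ≡ g (code φ)) →
  (∀ Q n → P (apply (θ Q) n) → ¬ ¬ Halts Q (initial n)) →
  (∀ Q n → Halts Q (initial n) → ¬ ¬ P (apply (θ Q) n)) →
  ¬ (∃ λ M → Decides code M P)
diagonalisation code P θ apply prog g computes-g code-apply sound complete (M , decides) =
  complete Q n (contrarian-halts prog M computes-g n (computes 0 (proj₂ (decides φ) ¬Pφ))) ¬Pφ
  where
  Q = contrarian prog M
  n = code (θ Q)
  φ = apply (θ Q) n
  computes : ∀ m → Computes M (code φ) m → Computes M (g n) m
  computes m = subst (λ k → Computes M k m) (code-apply (θ Q))
  ¬Pφ : ¬ P φ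
  ¬Pφ p = sound Q n p
    (contrarian-diverges prog M computes-g n (computes 1 (proj₁ (decides φ) p)))

-- Loop programs for Gödel numbers

-- In the programs below register 0 holds the input, register 1 the value being computed,
-- and registers 2 and 3 are scratch.
State : ℕ → ℕ → ℕ → ℕ → Vec ℕ 4
State n t u m = n ∷ t ∷ u ∷ m ∷ []

double odd powerOfInput : Cmd 4
double = loop 1F (inc 2F ⨾ inc 2F) ⨾ loop 2F (inc 1F)
odd = double ⨾ inc 1F
powerOfInput = loop 0F (inc 3F ⨾ double) ⨾ loop 3F (inc 0F)

times : ℕ → Cmd K → Cmd K
times zero    c = skip
times (suc k) c = times k c ⨾ c

run-double : ∀ n t m → Run double (State n t 0 m) (State n (2 * t) 0 m)
run-double n t m =
  spread t 0 ⨾ gather (2 * t + 0) 0 (trans (+-identityʳ (2 * t + 0)) (+-identityʳ (2 * t)))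
  where
  spread : ∀ t u → Run (loop 1F (inc 2F ⨾ inc 2F)) (State n t u m) (State n 0 (2 * t + u) m)
  spread zero    u = done refl
  spread (suc t) u = iter refl (inc ⨾ inc)
    (subst (λ a → Run (loop 1F (inc 2F ⨾ inc 2F)) (State n t (2 + u) m) (State n 0 a m)) eq
      (spread t (2 + u)))
    where
    eq : 2 * t + (2 + u) ≡ 2 * suc t + u
    eq = trans (sym (+-assoc (2 * t) 2 u))
      (cong (_+ u) (trans (+-comm (2 * t) 2) (sym (*-suc 2 t))))
  gather : ∀ u t {s} → u + t ≡ s → Run (loop 2F (inc 1F)) (State n t u m) (State n s 0 m)
  gather zero    t refl = done refl
  gather (suc u) t refl = iter refl inc (gather u (suc t) (+-suc u t))

run-odd : ∀ n t → Run odd (State n t 0 0) (State n (suc (2 * t)) 0 0)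
run-odd n t = run-double n t 0 ⨾ inc

run-times-double : ∀ k n t → Run (times k double) (State n t 0 0) (State n (2 ^ k * t) 0 0)
run-times-double zero    n t rewrite +-identityʳ t = skip
run-times-double (suc k) n t rewrite *-assoc 2 (2 ^ k) t =
  run-times-double k n t ⨾ run-double n (2 ^ k * t) 0

run-powerOfInput : ∀ n t → Run powerOfInput (State n t 0 0) (State n (2 ^ n * t) 0 0)
run-powerOfInput n t = powers n t 0 ⨾ restore (n + 0) 0 (trans (+-identityʳ (n + 0)) (+-identityʳ n))
  where
  powers : ∀ n t m →
    Run (loop 0F (inc 3F ⨾ double)) (State n t 0 m) (State 0 (2 ^ n * t) 0 (n + m))
  powers zero    t m rewrite +-identityʳ t = done refl
  powers (suc n) t m = iter refl (inc ⨾ run-double n t (suc m))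
    (subst₂ (λ a b → Run (loop 0F (inc 3F ⨾ double)) (State n (2 * t) 0 (suc m)) (State 0 a 0 b))
      (trans (sym (*-assoc (2 ^ n) 2 t)) (cong (_* t) (*-comm (2 ^ n) 2))) (+-suc n m)
      (powers n (2 * t) (suc m)))
  restore : ∀ m n′ {s} → m + n′ ≡ s →
    Run (loop 3F (inc 0F)) (State n′ (2 ^ n * t) 0 m) (State s (2 ^ n * t) 0 0)
  restore zero    n′ refl = done refl
  restore (suc m) n′ refl = iter refl inc (restore m (suc n′) (+-suc m n′))

-- Codes of nodes are built from the right: register 1 holds the code of the right subtree, and a
-- left subtree is added whose code is fixed (`pairConst`), is the input (`pairInput`), or is that
-- of the leaf labelled by the input (`pairLeafInput`). With `k = 0` the result is the code of a
-- leaf.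
pairConst : ℕ → Cmd 4
pairConst k = odd ⨾ times k double

run-pairConst : ∀ k n t → Run (pairConst k) (State n t 0 0) (State n (pair k t) 0 0)
run-pairConst k n t = run-odd n t ⨾ run-times-double k n (suc (2 * t))

pairInput : Cmd 4
pairInput = odd ⨾ powerOfInput ⨾ double

run-pairInput : ∀ n t → Run pairInput (State n t 0 0) (State n (pair (suc n) t) 0 0)
run-pairInput n t rewrite *-assoc 2 (2 ^ n) (suc (2 * t)) =
  run-odd n t ⨾ run-powerOfInput n _ ⨾ run-double n _ 0

-- The code of `leaf n` is `2 * n + 1`, so the factor needed is `2 ^ (2 * n + 2)`: two
-- multiplications by `2 ^ n` and two doublings.
pairLeafInput : Cmd 4
pairLeafInput = odd ⨾ powerOfInput ⨾ powerOfInput ⨾ double ⨾ double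

run-pairLeafInput : ∀ n t →
  Run pairLeafInput (State n t 0 0) (State n (pair (suc (codeTree (leaf n))) t) 0 0)
run-pairLeafInput n t =
  subst (λ a → Run pairLeafInput (State n t 0 0) (State n a 0 0)) eq
    (run-odd n t ⨾ run-powerOfInput n _ ⨾ run-powerOfInput n _ ⨾ run-double n _ 0 ⨾ run-double n _ 0)
  where
  s = suc (2 * t)
  eq : 2 * (2 * (2 ^ n * (2 ^ n * s))) ≡ pair (suc (codeTree (leaf n))) t
  eq = begin
    2 * (2 * (2 ^ n * (2 ^ n * s)))     ≡⟨ cong (λ a → 2 * (2 * a)) (*-assoc (2 ^ n) (2 ^ n) s) ⟨
    2 * (2 * (2 ^ n * 2 ^ n * s))       ≡⟨ cong (λ a → 2 * (2 * (a * s))) (^-distribˡ-+-* 2 n n) ⟨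
    2 * (2 * (2 ^ (n + n) * s))         ≡⟨ cong (2 *_) (*-assoc 2 (2 ^ (n + n)) s) ⟨
    2 * (2 ^ suc (n + n) * s)           ≡⟨ *-assoc 2 (2 ^ suc (n + n)) s ⟨
    2 ^ suc (suc (n + n)) * s           ≡⟨ cong (λ a → 2 ^ suc a * s) suc[n+n] ⟩
    2 ^ suc (codeTree (leaf n)) * s     ∎
    where
    open ≡-Reasoning
    suc[n+n] : suc (n + n) ≡ codeTree (leaf n)
    suc[n+n] = trans
      (cong (λ a → suc (n + a)) (sym (+-identityʳ n)))
      (sym (+-identityʳ (suc (2 * n))))

-- For the tags of ∧ and ≈X^, and n the code of t, diagonal n is the code of t ∧ 0 ≈X^[ n ] 1. The
-- tags stay abstract because evaluating these towers of powers is infeasible.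
module _ (conj-tag eq-tag one : ℕ) where

  diagonal : ℕ → ℕ
  diagonal n = pair conj-tag (pair (suc n) (pair eq-tag
    (pair eq-tag (pair (suc (codeTree (leaf n))) (codeTree (leaf one))))))

  computeDiagonal : Cmd 4
  computeDiagonal =
    times one (inc 1F) ⨾ pairConst 0 ⨾ pairLeafInput ⨾ pairConst eq-tag ⨾ pairConst eq-tag ⨾
    pairInput ⨾ pairConst conj-tag ⨾ loop 0F skip ⨾ loop 1F (inc 0F)

  run-computeDiagonal : ∀ n →
    Run computeDiagonal (State n 0 0 0) (State (diagonal n) 0 0 0)
  run-computeDiagonal n =
    count one ⨾ run-pairConst 0 n one ⨾ run-pairLeafInput n _ ⨾ run-pairConst eq-tag n _ ⨾
    run-pairConst eq-tag n _ ⨾ run-pairInput n _ ⨾ run-pairConst conj-tag n _ ⨾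
    clear n ⨾ move (diagonal n) 0 (+-identityʳ _)
    where
    count : ∀ k → Run (times k (inc 1F)) (State n 0 0 0) (State n k 0 0)
    count zero    = skip
    count (suc k) = count k ⨾ inc
    clear : ∀ n {t} → Run (loop 0F skip) (State n t 0 0) (State 0 t 0 0)
    clear zero    = done refl
    clear (suc n) = iter refl skip (clear n)
    move : ∀ t n {s} → t + n ≡ s → Run (loop 1F (inc 0F)) (State n t 0 0) (State s 0 0 0)
    move zero    n refl = done refl
    move (suc t) n refl = iter refl inc (move t (suc n) (+-suc t n))

-- `eq-tag` occurs twice because `leaf 0` is both the tag of `≈X^` and the leaf of the variable
-- `ref`; `one` is the variable `mark`.
diagonalisation-tree : ∀ {ℓ} {A : Set} (tree : A → Tree) (P : A → Set ℓ)
  (θ : Machine → A) (apply : A → ℕ → A) (conj-tag eq-tag : Tree) (one : ℕ) →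
  (∀ φ n → tree (apply φ n) ≡
    node conj-tag (node (tree φ) (node eq-tag (node eq-tag (node (leaf n) (leaf one)))))) →
  (∀ Q n → P (apply (θ Q) n) → ¬ ¬ Halts Q (initial n)) →
  (∀ Q n → Halts Q (initial n) → ¬ ¬ P (apply (θ Q) n)) →
  ¬ (∃ λ M → Decides (λ φ → codeTree (tree φ)) M P)
diagonalisation-tree tree P θ apply conj-tag eq-tag one tree-apply =
  diagonalisation (λ φ → codeTree (tree φ)) P θ apply
    (computeDiagonal k k′ one) (diagonal k k′ one) (run-computeDiagonal k k′ one)
    (λ φ → cong codeTree (tree-apply φ (codeTree (tree φ))))
  where
  k = suc (codeTree conj-tag)
  k′ = suc (codeTree eq-tag)

-- The formula of a machine

register : Instr → ℕ
register (inc r)   = r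
register (dec r l) = r

width : Machine → ℕ
width []      = 0
width (I ∷ M) = suc (register I) ⊔ width M

register<width : ∀ M k {I} → fetch M k ≡ just I → register I < width M
register<width []      k       f with () ← trans (sym f) (fetch-[] k)
register<width (I ∷ M) zero    refl = m≤m⊔n (suc (register I)) (width M)
register<width (I ∷ M) (suc k) f    =
  ≤-trans (register<width M k f) (m≤n⊔m (suc (register I)) (width M))

⊤′ : LRC⊤
⊤′ = ∼ (0 <XF 0 ∧ ∼ 0 <XF 0)

infix 9 _≐_
_≐_ : Var → Var → LRC⊤
x ≐ y = x ≈X^[ 0 ] y

never : LRC⊤ → LRC⊤
never φ = ∼ (⊤′ U φ)

⋀ : ℕ → (ℕ → LRC⊤) → LRC⊤
⋀ zero    f = ⊤′
⋀ (suc n) f = f n ∧ ⋀ n f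

changes : Bool → Var → LRC⊤
changes true  v = ∼ v ≈X^[ 1 ] v
changes false v = v ≈X^[ 1 ] v

-- The run is at address p when the variable line p has the value of the constant variable ref.
-- The counter r is the number of changes of pushed r minus that of popped r.
ref mark : Var
ref  = 0
mark = 1

line pushed popped : ℕ → Var
line   zero    = 2
line   (suc p) = 3 + line p
pushed zero    = 3
pushed (suc r) = 3 + pushed r
popped zero    = 4
popped (suc r) = 3 + popped r

at : ℕ → LRC⊤
at p = line p ≐ ref

marked : LRC⊤
marked = ref ≐ mark

data Effect : Set where
  idle     : Effect
  push pop : ℕ → Effect

pushes pops : Effect → ℕ → Bool
pushes (push r) s = s ≡ᵇ r
pushes _        s = false
pops   (pop r)  s = s ≡ᵇ r
pops   _        s = false

module Formula (Q : Machine) where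

  effect : Effect → LRC⊤
  effect e = ⋀ (width Q) λ r → changes (pushes e r) (pushed r) ∧ changes (pops e r) (popped r)

  goto : ℕ → Effect → LRC⊤
  goto p e = X at p ∧ effect e

  -- Each conjunct `∼ (A ∧ ∼ B)` is an implication from `A` to `B`; read constructively it yields
  -- `B` only up to double negation.
  rule : ℕ → Maybe Instr → LRC⊤
  rule p nothing          = ⊤′
  rule p (just (inc r))   = ∼ (at p ∧ ∼ goto (suc p) (push r))
  rule p (just (dec r l)) =
    ∼ (at p ∧ (pushed r ≐ popped r ∧ ∼ goto l idle)) ∧
    ∼ (at p ∧ (∼ pushed r ≐ popped r ∧ ∼ goto (suc p) (pop r)))

  -- The last two invariants: popped r only takes values that pushed r has taken, and it does not
  -- jump over any of them.
  queue : ℕ → LRC⊤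
  queue r =
    never (pushed r >XF pushed r) ∧ never (popped r >XF popped r) ∧
    never (∼ popped r ≐ pushed r ∧ ∼ popped r ≈XF⁻¹ pushed r) ∧
    never (∼ pushed r ≐ popped r ∧ (∼ pushed r ≈XF popped r ∧ pushed r <XF popped r)) ∧
    pushed r ≐ popped r

  rules halted run boot halting : LRC⊤
  rules   = ⋀ (length Q) λ p → rule p (fetch Q p)
  halted  = ⋀ (length Q) λ p → ∼ at p
  run     = at 0 ∧ (rules U halted)
  -- Position n is the marked one, so register 0 has been incremented n times when the run starts.
  boot    = (∼ marked ∧ effect (push 0)) U (marked ∧ (X never marked ∧ run))
  halting = ⋀ (width Q) queue ∧ (never (∼ ref ≈X^[ 1 ] ref) ∧ boot)

-- Evaluated at position 0, this says that position `n` is marked, because `halting` keeps `ref`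
-- constant. As `boot` allows a single marked position, the run starts at `n`.
input : ℕ → LRC⊤
input n = ref ≈X^[ n ] mark

-- Satisfaction of the derived connectives

module Satisfaction {a ℓ} {D : Set a} (_≺_ : Rel D ℓ) (σ : Model D) where

  open Semantics _≺_ using () renaming (_,_⊨⊤_ to infix 3 _⊩[_]_)

  ≐-elim : ∀ x y {i} → σ ⊩[ i ] x ≐ y → σ i x ≡ σ i y
  ≐-elim x y {i} (lift eq) = subst (λ j → σ i x ≡ σ j y) (+-identityʳ i) eq

  ≐-intro : ∀ x y {i} → σ i x ≡ σ i y → σ ⊩[ i ] x ≐ y
  ≐-intro x y {i} eq = lift (subst (λ j → σ i x ≡ σ j y) (sym (+-identityʳ i)) eq)

  unchanged-elim : ∀ x {i} → σ ⊩[ i ] changes false x → σ i x ≡ σ (suc i) x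
  unchanged-elim x {i} (lift eq) = subst (λ j → σ i x ≡ σ j x) (+-comm i 1) eq

  unchanged-intro : ∀ x {i} → σ i x ≡ σ (suc i) x → σ ⊩[ i ] changes false x
  unchanged-intro x {i} eq = lift (subst (λ j → σ i x ≡ σ j x) (+-comm 1 i) eq)

  ⊤′-intro : ∀ {i} → σ ⊩[ i ] ⊤′
  ⊤′-intro (p , ¬p) = ¬p p

  never-elim : ∀ φ {i} → σ ⊩[ i ] never φ → ∀ j → i ≤ j → ¬ (σ ⊩[ j ] φ)
  never-elim φ ¬u j i≤j p = ¬u (j , i≤j , p , λ k _ _ → ⊤′-intro {k})

  never-intro : ∀ φ {i} → (∀ j → i ≤ j → ¬ (σ ⊩[ j ] φ)) → σ ⊩[ i ] never φ
  never-intro φ h (j , i≤j , p , _) = h j i≤j p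

  ⋀-elim : ∀ n f {i} → σ ⊩[ i ] ⋀ n f → ∀ k → k < n → σ ⊩[ i ] f k
  ⋀-elim (suc n) f (p , ps) k k<1+n with m<1+n⇒m<n∨m≡n k<1+n
  ... | inj₁ k<n  = ⋀-elim n f ps k k<n
  ... | inj₂ refl = p

  ⋀-intro : ∀ n f {i} → (∀ k → k < n → σ ⊩[ i ] f k) → σ ⊩[ i ] ⋀ n f
  ⋀-intro zero    f {i} h = ⊤′-intro {i}
  ⋀-intro (suc n) f h = h n (n<1+n n) , ⋀-intro n f λ k k<n → h k (m<n⇒m<1+n k<n)

-- Correctness of the zero test

module Counter {a ℓ} {D : Set a} {_≺_ : Rel D ℓ} (sto : IsStrictTotalOrder _≡_ _≺_)
  (x y : ℕ → D)
  (x-mono : ∀ i j → i < j → ¬ (x j ≺ x i))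
  (y-mono : ∀ i j → i < j → ¬ (y j ≺ y i))
  (y-past : ∀ i → y i ≢ x i → ¬ ¬ (∃[ j ] j < i × y i ≡ x j))
  (x-future : ∀ i → x i ≢ y i → ¬ (∃[ j ] i < j × x i ≡ y j) → ¬ (∃[ j ] i < j × x i ≺ y j)) where

  open IsStrictTotalOrder sto
    using (compare) renaming (trans to ≺-trans; irrefl to ≺-irrefl)

  private
    rises : ∀ {z : ℕ → D} {i} → (∀ i j → i < j → ¬ (z j ≺ z i)) → z i ≢ z (suc i) → z i ≺ z (suc i)
    rises {z} {i} mono ne with compare (z i) (z (suc i))
    ... | tri< lt _ _ = lt
    ... | tri≈ _ eq _ = contradiction eq ne
    ... | tri> _ _ gt = contradiction gt (mono i (suc i) (n<1+n i))

    below : ∀ {z : ℕ → D} {i j d} → (∀ i j → i < j → ¬ (z j ≺ z i)) → i ≤ j → z j ≺ d → z i ≺ d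
    below {z} {i} {j} mono i≤j zj≺d with m≤n⇒m<n∨m≡n i≤j
    ... | inj₂ refl = zj≺d
    ... | inj₁ i<j with compare (z i) (z j)
    ...   | tri< lt _ _ = ≺-trans lt zj≺d
    ...   | tri≈ _ eq _ = subst (_≺ _) (sym eq) zj≺d
    ...   | tri> _ _ gt = contradiction gt (mono i j i<j)

    above : ∀ {z : ℕ → D} {i j d} → (∀ i j → i < j → ¬ (z j ≺ z i)) → i ≤ j → d ≺ z i → d ≺ z j
    above {z} {i} {j} mono i≤j d≺zi with m≤n⇒m<n∨m≡n i≤j
    ... | inj₂ refl = d≺zi
    ... | inj₁ i<j with compare (z i) (z j)
    ...   | tri< lt _ _ = ≺-trans d≺zi lt
    ...   | tri≈ _ eq _ = subst (_ ≺_) eq d≺zi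
    ...   | tri> _ _ gt = contradiction gt (mono i j i<j)

  data Rises (k : ℕ) : ℕ → ℕ → Set a where
    here : Rises k k 0
    flat : ∀ {i c} → Rises k i c → x i ≡ x (suc i) → Rises k (suc i) c
    rise : ∀ {i c} → Rises k i c → x i ≢ x (suc i) → Rises k (suc i) (suc c)

  Rises-zero : ∀ {k i} → Rises k i 0 → x k ≡ x i
  Rises-zero here       = refl
  Rises-zero (flat p e) = trans (Rises-zero p) e

  Rises-suc : ∀ {k i c} → Rises k i (suc c) → x k ≺ x i
  Rises-suc {k} (flat p e) = subst (x k ≺_) e (Rises-suc p)
  Rises-suc {k} {suc i} {zero}  (rise p ne) =
    subst (_≺ x (suc i)) (sym (Rises-zero p)) (rises x-mono ne)
  Rises-suc {c = suc c} (rise p ne) = ≺-trans (Rises-suc p) (rises x-mono ne)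

  -- Splits off the oldest change: `x (suc m)` is the value that `y` has to take next.
  first-rise : ∀ {k i c} → Rises k i (suc c) →
    ∃[ m ] m < i × x k ≡ x m × x m ≢ x (suc m) × Rises (suc m) i c
  first-rise (flat p e) with first-rise p
  ... | m , m<i , eq , ne , q = m , m<n⇒m<1+n m<i , eq , ne , flat q e
  first-rise {c = zero}  (rise {i} p ne) = i , n<1+n i , Rises-zero p , ne , here
  first-rise {c = suc c} (rise p ne) with first-rise p
  ... | m , m<i , eq , ne′ , q = m , m<n⇒m<1+n m<i , eq , ne′ , rise q ne

  -- c values of x are still to be taken by y.
  Pending : ℕ → ℕ → Set a
  Pending i c = ∃[ k ] x k ≡ y i × Rises k i c

  pending-start : x 0 ≡ y 0 → Pending 0 0
  pending-start eq = 0 , eq , here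

  pending-zero : ∀ {i} → Pending i 0 → x i ≡ y i
  pending-zero (k , eq , p) = trans (sym (Rises-zero p)) eq

  -- Since `x` is monotone, it has left the value still held by `y` for good, so a nonzero counter
  -- is never mistaken for zero.
  pending-suc : ∀ {i c} → Pending i (suc c) → x i ≢ y i
  pending-suc (k , eq , p) eq′ = ≺-irrefl (trans eq (sym eq′)) (Rises-suc p)

  pending-idle : ∀ {i c} → x i ≡ x (suc i) → y i ≡ y (suc i) → Pending i c → Pending (suc i) c
  pending-idle ex ey (k , eq , p) = k , trans eq ey , flat p ex

  pending-push : ∀ {i c} → x i ≢ x (suc i) → y i ≡ y (suc i) → Pending i c → Pending (suc i) (suc c)
  pending-push nx ey (k , eq , p) = k , trans eq ey , rise p nx

  -- Here `y` rises from `x m` and must land on `x (suc m)`. If it landed higher, monotonicity would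
  -- keep `y` off the value `x (suc m)` at all positions, yet `y` exceeds it at `suc i`, which is
  -- later than `suc m`: this violates `x-future`. If it landed lower, its value would lie strictly
  -- between two consecutive values of `x`, which violates `y-past`.
  pending-pop : ∀ {i c} → x i ≡ x (suc i) → y i ≢ y (suc i) → Pending i (suc c) → Pending (suc i) c
  pending-pop {i} ex ny (k , eq , p) with first-rise p
  ... | m , m<i , xk≡xm , ne , q = suc m , next , flat q ex
    where
    yi≡xm : y i ≡ x m
    yi≡xm = trans (sym eq) xk≡xm
    yi≺next : y i ≺ x (suc m)
    yi≺next = subst (_≺ x (suc m)) (sym yi≡xm) (rises x-mono ne)
    xm≺next : x m ≺ y (suc i)
    xm≺next = subst (_≺ y (suc i)) yi≡xm (rises y-mono ny)

    next : x (suc m) ≡ y (suc i)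
    next with compare (x (suc m)) (y (suc i))
    ... | tri≈ _ e _  = e
    ... | tri< lt _ _ = contradiction (suc i , s<s m<i , lt)
      (x-future (suc m) (skipped (suc m)) λ (j , _ , e) → skipped j e)
      where
      skipped : ∀ j → x (suc m) ≢ y j
      skipped j e with <-≤-connex i j
      ... | inj₁ i<j = ≺-irrefl e (above y-mono i<j lt)
      ... | inj₂ j≤i = ≺-irrefl (sym e) (below y-mono j≤i yi≺next)
    ... | tri> _ _ gt = contradiction (λ (j , _ , e) → foreign j e) (y-past (suc i) (foreign (suc i)))
      where
      foreign : ∀ j → y (suc i) ≢ x j
      foreign j e with <-≤-connex m j
      ... | inj₁ m<j = ≺-irrefl e (above x-mono m<j gt)
      ... | inj₂ j≤m = ≺-irrefl (sym e) (below x-mono j≤m xm≺next)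

-- Soundness: from a model to a halting run

Moves : (pushed? popped? : Bool) → (c c′ : ℕ) → Set
Moves true  true  c c′ = ⊥
Moves true  false c c′ = c′ ≡ suc c
Moves false true  c c′ = c ≡ suc c′
Moves false false c c′ = c ≡ c′

Updates : Effect → Registers → Registers → Set
Updates e ρ ρ′ = ∀ r → Moves (pushes e r) (pops e r) (ρ r) (ρ′ r)

push-updates : ∀ r ρ → Updates (push r) ρ (ρ [ r ≔ suc (ρ r) ])
push-updates r ρ s with s ≡ᵇ r in eq
... | true  = cong (suc ∘ ρ) (sym (≡ᵇ⇒≡ s r (subst T (sym eq) _)))
... | false = refl

pop-updates : ∀ r ρ {v} → ρ r ≡ suc v → Updates (pop r) ρ (ρ [ r ≔ v ])
pop-updates r ρ ρr≡ s with s ≡ᵇ r in eq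
... | true  = trans (cong ρ (≡ᵇ⇒≡ s r (subst T (sym eq) _))) ρr≡
... | false = refl

module Soundness {a ℓ} {D : Set a} {_≺_ : Rel D ℓ} (sto : IsStrictTotalOrder _≡_ _≺_)
  (Q : Machine) (n : ℕ) (σ : Model D) where

  open Semantics _≺_ using () renaming (_,_⊨⊤_ to infix 3 _⊩[_]_)
  open Satisfaction _≺_ σ
  open Formula Q
  open IsStrictTotalOrder sto using () renaming (_≟_ to _≟ᴰ_)

  module _ (queues : ∀ r → r < width Q → σ ⊩[ 0 ] queue r) where

    private
      module C (r : ℕ) (r<w : r < width Q) where
        open Counter sto (λ i → σ i (pushed r)) (λ i → σ i (popped r))
          (λ i j i<j lt → never-elim (pushed r >XF pushed r)
            (proj₁ (queues r r<w)) i z≤n (lift (j , i<j , lt)))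
          (λ i j i<j lt → never-elim (popped r >XF popped r)
            (proj₁ (proj₂ (queues r r<w))) i z≤n (lift (j , i<j , lt)))
          (λ i ne ¬past → never-elim (∼ popped r ≐ pushed r ∧ ∼ popped r ≈XF⁻¹ pushed r)
            (proj₁ (proj₂ (proj₂ (queues r r<w)))) i z≤n
            (ne ∘ ≐-elim (popped r) (pushed r) , ¬past ∘ lower))
          (λ i ne ¬future lt → never-elim
            (∼ pushed r ≐ popped r ∧ (∼ pushed r ≈XF popped r ∧ pushed r <XF popped r))
            (proj₁ (proj₂ (proj₂ (proj₂ (queues r r<w))))) i z≤n
            (ne ∘ ≐-elim (pushed r) (popped r) , ¬future ∘ lower , lift lt))
          public

    Represents : ℕ → Registers → Set a
    Represents i ρ = ∀ r (r<w : r < width Q) → C.Pending r r<w i (ρ r)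

    represents-start : Represents 0 (proj₂ (initial 0))
    represents-start r r<w = subst (C.Pending r r<w 0) (initial-0 r)
      (C.pending-start r r<w
        (≐-elim (pushed r) (popped r) (proj₂ (proj₂ (proj₂ (proj₂ (queues r r<w)))))))
      where
      initial-0 : ∀ r → 0 ≡ proj₂ (initial 0) r
      initial-0 zero    = refl
      initial-0 (suc r) = refl

    represents-step : ∀ {i ρ ρ′} e → Updates e ρ ρ′ → σ ⊩[ i ] effect e →
      Represents i ρ → Represents (suc i) ρ′
    represents-step {i} {ρ} {ρ′} e upd eff rep r r<w =
      go (pushes e r) (pops e r) (upd r) (⋀-elim (width Q) _ eff r r<w) (rep r r<w)
      where
      go : ∀ b b′ {c c′} → Moves b b′ c c′ →
        σ ⊩[ i ] changes b (pushed r) ∧ changes b′ (popped r) →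
        C.Pending r r<w i c → C.Pending r r<w (suc i) c′
      go true  false refl (p , q) =
        C.pending-push r r<w (p ∘ unchanged-intro (pushed r)) (unchanged-elim (popped r) q)
      go false true  refl (p , q) =
        C.pending-pop r r<w (unchanged-elim (pushed r) p) (q ∘ unchanged-intro (popped r))
      go false false refl (p , q) =
        C.pending-idle r r<w (unchanged-elim (pushed r) p) (unchanged-elim (popped r) q)

    -- Induction on the number `k` of positions left before `halted`. At `k = 0` an address inside
    -- the program contradicts `halted`; if the address leaves the program earlier, the run has
    -- already ended. The double negation comes from the implications in `rule`.
    follow : ∀ k i {pc ρ} → σ i (line pc) ≡ σ i ref → Represents i ρ →
      (∀ m → i ≤ m → m < i + k → σ ⊩[ m ] rules) → σ ⊩[ i + k ] halted →
      ¬ ¬ Halts Q (pc , ρ)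
    follow k i {pc} {ρ} at-pc rep obeys halts ¬halts with fetch Q pc in f
    ... | nothing = ¬halts (ρ , halt f)
    follow zero i {pc} {ρ} at-pc rep obeys halts ¬halts | just I =
      ⋀-elim (length Q) (λ p → ∼ at p) halts pc (fetch-just⇒< Q pc f)
        (≐-intro (line pc) ref (subst (λ j → σ j (line pc) ≡ σ j ref) (sym (+-identityʳ i)) at-pc))
    follow (suc k) i {pc} {ρ} at-pc rep obeys halts ¬halts | just I = proceed I f rule-pc
      where
      pc<length = fetch-just⇒< Q pc f

      rule-pc : σ ⊩[ i ] rule pc (just I)
      rule-pc = subst (λ J → σ ⊩[ i ] rule pc J) f
        (⋀-elim (length Q) (λ p → rule p (fetch Q p)) (obeys i ≤-refl (m<m+n i z<s)) pc pc<length)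

      next : ∀ {p ρ′} e → Updates e ρ ρ′ → σ ⊩[ i ] goto p e → ¬ ¬ Halts Q (p , ρ′)
      next {p} e upd (at-p , eff) =
        follow k (suc i) (≐-elim (line p) ref at-p) (represents-step e upd eff rep)
          (λ m i<m m<j → obeys m (<⇒≤ i<m) (subst (m <_) (sym (+-suc i k)) m<j))
          (subst (λ j → σ ⊩[ j ] halted) (+-suc i k) halts)

      proceed : ∀ I → fetch Q pc ≡ just I → σ ⊩[ i ] rule pc (just I) → ⊥
      proceed (inc r) f rl = rl (≐-intro (line pc) ref at-pc , λ g →
        next (push r) (push-updates r ρ) g (¬halts ∘ proj₂ (≋-step f refl)))
      proceed (dec r l) f (rl₀ , rl₁) with ρ r in eq | rep r (register<width Q pc f)
      ... | zero | pend =
        rl₀ (≐-intro (line pc) ref at-pc ,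
             ≐-intro (pushed r) (popped r) (C.pending-zero r (register<width Q pc f) pend) , λ g →
          next idle (λ _ → refl) g (¬halts ∘ proj₂ (≋-step f (exec-dec-zero eq))))
      ... | suc v | pend =
        rl₁ (≐-intro (line pc) ref at-pc ,
             C.pending-suc r (register<width Q pc f) pend ∘ ≐-elim (pushed r) (popped r) , λ g →
          next (pop r) (pop-updates r ρ eq) g (¬halts ∘ proj₂ (≋-step f (exec-dec-suc eq))))

  halts : σ ⊩[ 0 ] halting ∧ input n → ¬ ¬ Halts Q (initial n)
  halts ((qs , constant , j , _ , (_ , once , at-0 , k , j≤k , halted-k , obeys) , booting) ,
         lift ref≡mark) =
    subst (λ m → ¬ ¬ Halts Q (initial m)) (sym n≡j)
      (follow queues (k ∸ j) j (≐-elim (line 0) ref at-0) (booted j ≤-refl)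
        (λ m j≤m m<k → obeys m j≤m (subst (m <_) (m+[n∸m]≡n j≤k) m<k))
        (subst (λ j → σ ⊩[ j ] halted) (sym (m+[n∸m]≡n j≤k)) halted-k))
    where
    ref-constant : ∀ i → σ i ref ≡ σ 0 ref
    ref-constant zero    = refl
    -- `never` only refutes the inequality; decidability of equality turns this into an equation.
    ref-constant (suc i) = trans (sym (decidable-stable (σ i ref ≟ᴰ σ (suc i) ref) λ ne →
      never-elim (∼ ref ≈X^[ 1 ] ref) constant i z≤n (ne ∘ unchanged-elim ref)))
      (ref-constant i)

    marked-n : σ ⊩[ n ] marked
    marked-n = ≐-intro ref mark (trans (ref-constant n) ref≡mark)

    -- The left side of the `U` in `boot` excludes marks before `j`, and `once` excludes marks after
    -- `j`.
    n≡j : n ≡ j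
    n≡j with <-cmp n j
    ... | tri≈ _ n≡j _ = n≡j
    ... | tri< n<j _ _ = contradiction marked-n (proj₁ (booting n z≤n n<j))
    ... | tri> _ _ j<n = contradiction marked-n (never-elim marked once n j<n)

    queues = ⋀-elim (width Q) queue qs

    booted : ∀ i → i ≤ j → Represents queues i (proj₂ (initial i))
    booted zero    _   = represents-start queues
    booted (suc i) i<j = represents-step queues (push 0) (λ { zero → refl ; (suc r) → refl })
      (proj₂ (booting i z≤n i<j)) (booted i (<⇒≤ i<j))

-- Completeness: from a halting run to a model over ℕ

data Meaning : Set where
  isRef isMark             : Meaning
  isLine isPushed isPopped : ℕ → Meaning

next-index : Meaning → Meaning
next-index isRef        = isRef
next-index isMark       = isMark
next-index (isLine p)   = isLine (suc p)
next-index (isPushed r) = isPushed (suc r)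
next-index (isPopped r) = isPopped (suc r)

meaning : Var → Meaning
meaning 0 = isRef
meaning 1 = isMark
meaning 2 = isLine 0
meaning 3 = isPushed 0
meaning 4 = isPopped 0
-- Subtracting 3 lowers the index within the same family. As `v` is at least 2, it is never `ref` or
-- `mark`.
meaning (suc (suc (suc v@(suc (suc _))))) = next-index (meaning v)

meaning-line : ∀ p → meaning (line p) ≡ isLine p
meaning-line zero          = refl
meaning-line (suc zero)    = refl
meaning-line (suc (suc p)) = cong next-index (meaning-line (suc p))

meaning-pushed : ∀ r → meaning (pushed r) ≡ isPushed r
meaning-pushed zero          = refl
meaning-pushed (suc zero)    = refl
meaning-pushed (suc (suc r)) = cong next-index (meaning-pushed (suc r))

meaning-popped : ∀ r → meaning (popped r) ≡ isPopped r
meaning-popped zero          = refl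
meaning-popped (suc zero)    = refl
meaning-popped (suc (suc r)) = cong next-index (meaning-popped (suc r))

Slow : (ℕ → ℕ) → Set
Slow f = ∀ i → ∃[ b ] f (suc i) ≡ (if b then suc (f i) else f i)

slow-≤ : ∀ {f} → Slow f → ∀ {i j} → i ≤′ j → f i ≤ f j
slow-≤ slow ≤′-refl = ≤-refl
slow-≤ slow {j = suc j} (≤′-step i≤j) with slow j
... | true  , eq rewrite eq = m≤n⇒m≤1+n (slow-≤ slow i≤j)
... | false , eq rewrite eq = slow-≤ slow i≤j

slow-bound : ∀ {f} → Slow f → f 0 ≡ 0 → ∀ i → f i ≤ i
slow-bound slow f0 zero    = ≤-reflexive f0
slow-bound slow f0 (suc i) with slow i
... | true  , eq rewrite eq = s≤s (slow-bound slow f0 i)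
... | false , eq rewrite eq = m≤n⇒m≤1+n (slow-bound slow f0 i)

-- A discrete intermediate value theorem. It supplies the earlier and later occurrences of values
-- that `queue` demands.
slow-attains : ∀ {f} → Slow f → ∀ {i j v} → i ≤′ j → f i ≤ v → v ≤ f j →
  ∃[ k ] i ≤ k × k ≤ j × f k ≡ v
slow-attains slow {i} ≤′-refl fi≤v v≤fi = i , ≤-refl , ≤-refl , ≤-antisym fi≤v v≤fi
slow-attains {f} slow {j = suc j} {v} (≤′-step i≤j) fi≤v v≤fj with v ≤? f j
... | yes v≤fj′ with slow-attains slow i≤j fi≤v v≤fj′
...   | k , i≤k , k≤j , eq = k , i≤k , m≤n⇒m≤1+n k≤j , eq
slow-attains {f} slow {j = suc j} {v} (≤′-step i≤j) fi≤v v≤fj | no v≰fj with slow j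
... | true  , eq = suc j , m≤n⇒m≤1+n (≤′⇒≤ i≤j) , ≤-refl ,
  ≤-antisym (subst (_≤ v) (sym eq) (≰⇒> v≰fj)) v≤fj
... | false , eq = contradiction (subst (v ≤_) eq v≤fj) v≰fj

module Completeness (Q : Machine) (n : ℕ) where

  open Formula Q

  record Snapshot : Set where
    constructor ⟨_,_,_⟩
    field
      address : ℕ
      ups downs : ℕ → ℕ

  open Snapshot

  apply : ℕ × Effect → Snapshot → Snapshot
  apply (p , e) s = ⟨ p , (λ r → if pushes e r then suc (ups s r) else ups s r)
                        , (λ r → if pops e r then suc (downs s r) else downs s r) ⟩

  -- The zero test compares the two totals, so the model is defined without reference to a run;
  -- `Counts` links it to the registers. Outside the program the snapshot repeats forever, which
  -- keeps the values bounded.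
  reaction : Maybe Instr → Snapshot → ℕ × Effect
  reaction nothing          s = address s , idle
  reaction (just (inc r))   s = suc (address s) , push r
  reaction (just (dec r l)) s =
    if ups s r ≡ᵇ downs s r then (l , idle) else (suc (address s) , pop r)

  action : ℕ → Snapshot → ℕ × Effect
  action i s with i <? n
  ... | yes _ = 0 , push 0
  ... | no  _ = reaction (fetch Q (address s)) s

  state : ℕ → Snapshot
  state zero    = ⟨ 0 , (λ _ → 0) , (λ _ → 0) ⟩
  state (suc i) = apply (action i (state i)) (state i)

  action-boot : ∀ {i} s → i < n → action i s ≡ (0 , push 0)
  action-boot {i} s i<n with i <? n
  ... | yes _  = refl
  ... | no i≮n = contradiction i<n i≮n

  action-run : ∀ {i} s → n ≤ i → action i s ≡ reaction (fetch Q (address s)) s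
  action-run {i} s n≤i with i <? n
  ... | yes i<n = contradiction n≤i (<⇒≱ i<n)
  ... | no _    = refl

  value : ℕ → Meaning → ℕ
  value i isRef        = 0
  value i isMark       = if i ≡ᵇ n then 0 else 1
  value i (isLine p)   = if address (state i) ≡ᵇ p then 0 else 1
  value i (isPushed r) = ups (state i) r
  value i (isPopped r) = downs (state i) r

  τ : Model ℕ
  τ i v = value i (meaning v)

  ups-slow : ∀ r → Slow (λ i → ups (state i) r)
  ups-slow r i = pushes (proj₂ (action i (state i))) r , refl

  downs-slow : ∀ r → Slow (λ i → downs (state i) r)
  downs-slow r i = pops (proj₂ (action i (state i))) r , refl

  reaction-zero : ∀ {r l} s → ups s r ≡ downs s r → reaction (just (dec r l)) s ≡ (l , idle)
  reaction-zero {r} s eq rewrite dec-true (ups s r ≟ downs s r) eq = refl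

  reaction-suc : ∀ {r l} s → ups s r ≢ downs s r →
    reaction (just (dec r l)) s ≡ (suc (address s) , pop r)
  reaction-suc {r} s ne rewrite dec-false (ups s r ≟ downs s r) ne = refl

  -- A pop comes only from the nonzero branch of a `dec`, where the test has found the two totals
  -- different.
  action-safe : ∀ i s r → pops (proj₂ (action i s)) r ≡ true → downs s r ≢ ups s r
  action-safe i s r eq with i <? n
  ... | no _ with fetch Q (address s)
  ...   | just (dec r′ l) = dec-safe (ups s r′ ≟ downs s r′)
    where
    pops-r : ℕ × Effect → Bool
    pops-r a = pops (proj₂ a) r
    dec-safe : Dec (ups s r′ ≡ downs s r′) → downs s r ≢ ups s r
    dec-safe (yes eq′) with () ← trans (sym (cong pops-r (reaction-zero {r′} {l} s eq′))) eq
    dec-safe (no ne) eq″ = ne (subst (λ q → ups s q ≡ downs s q) r≡r′ (sym eq″))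
      where
      r≡r′ : r ≡ r′
      r≡r′ = ≡ᵇ⇒≡ r r′ (subst T (trans (sym eq) (cong pops-r (reaction-suc {r′} {l} s ne))) _)

  downs≤ups : ∀ i r → downs (state i) r ≤ ups (state i) r
  downs≤ups zero    r = z≤n
  downs≤ups (suc i) r
    with pushes (proj₂ (action i (state i))) r | pops (proj₂ (action i (state i))) r in eq
  ... | true  | true  = s≤s (downs≤ups i r)
  ... | true  | false = m≤n⇒m≤1+n (downs≤ups i r)
  ... | false | true  = ≤∧≢⇒< (downs≤ups i r) (action-safe i (state i) r eq)
  ... | false | false = downs≤ups i r

  Counts : ℕ → Registers → Set
  Counts i ρ = ∀ r → ups (state i) r ≡ downs (state i) r + ρ r

  counts-step : ∀ {i p e ρ ρ′} → action i (state i) ≡ (p , e) → Updates e ρ ρ′ →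
    Counts i ρ → Counts (suc i) ρ′
  counts-step {i} {p} {e} {ρ} {ρ′} act upd cnt r rewrite act =
    go (pushes e r) (pops e r) (upd r)
    where
    u = ups (state i) r
    d = downs (state i) r
    go : ∀ b b′ → Moves b b′ (ρ r) (ρ′ r) →
      (if b then suc u else u) ≡ (if b′ then suc d else d) + ρ′ r
    go true  false eq rewrite eq = trans (cong suc (cnt r)) (sym (+-suc d (ρ r)))
    go false true  eq = trans (cnt r) (trans (cong (d +_) eq) (+-suc d (ρ′ r)))
    go false false eq = trans (cnt r) (cong (d +_) eq)

  address-step : ∀ {i p e} → action i (state i) ≡ (p , e) → address (state (suc i)) ≡ p
  address-step act = cong proj₁ act

  booted : ∀ i → i ≤ n → address (state i) ≡ 0 × Counts i (proj₂ (initial i))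
  booted zero    _   = refl , λ { zero → refl ; (suc r) → refl }
  booted (suc i) i<n =
    address-step (action-boot (state i) i<n) ,
    counts-step {i} (action-boot (state i) i<n) (λ { zero → refl ; (suc r) → refl })
      (proj₂ (booted i (<⇒≤ i<n)))

  -- Induction on the derivation, one position per machine step. By `Counts` the totals agree
  -- exactly when the register is 0, so the tests of machine and model take the same branch.
  reaches-halt : ∀ {i c ρ′} → n ≤ i → address (state i) ≡ proj₁ c → Counts i (proj₂ c) →
    Q ⊢ c ⇓ ρ′ → ∃[ j ] n ≤ j × fetch Q (address (state j)) ≡ nothing
  reaches-halt {i} n≤i refl cnt (halt f) = i , n≤i , f
  reaches-halt {i} n≤i refl cnt (step {ρ = ρ} {I = I} f d) = proceed I act d
    where
    act : action i (state i) ≡ reaction (just I) (state i)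
    act = trans (action-run (state i) n≤i) (cong (λ J → reaction J (state i)) f)

    next : ∀ {p e ρ₁ ρ′} → action i (state i) ≡ (p , e) → Updates e ρ ρ₁ → Q ⊢ p , ρ₁ ⇓ ρ′ →
      ∃[ j ] n ≤ j × fetch Q (address (state j)) ≡ nothing
    next act upd d =
      reaches-halt (m≤n⇒m≤1+n n≤i) (address-step act) (counts-step {i} act upd cnt) d

    proceed : ∀ I {ρ′} → action i (state i) ≡ reaction (just I) (state i) →
      Q ⊢ exec I (address (state i) , ρ) ⇓ ρ′ →
      ∃[ j ] n ≤ j × fetch Q (address (state j)) ≡ nothing
    proceed (inc r) act d = next act (push-updates r ρ) d
    proceed (dec r l) act d with ρ r in eq
    ... | zero = next (trans act (reaction-zero (state i)
      (trans (cnt r) (trans (cong (downs (state i) r +_) eq) (+-identityʳ _))))) (λ _ → refl) d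
    ... | suc v = next (trans act (reaction-suc (state i) λ e →
      m+1+n≢m (downs (state i) r) (trans (sym (trans (cnt r) (cong (downs (state i) r +_) eq))) e)))
      (pop-updates r ρ eq) d

  private
    _⊩[_]_ : Model ℕ → ℕ → LRC⊤ → Set
    _⊩[_]_ = Semantics._,_⊨⊤_ _<_

    infix 3 _⊩[_]_

  open Satisfaction _<_ τ

  τ-pushed : ∀ i r → τ i (pushed r) ≡ ups (state i) r
  τ-pushed i r = cong (value i) (meaning-pushed r)

  τ-popped : ∀ i r → τ i (popped r) ≡ downs (state i) r
  τ-popped i r = cong (value i) (meaning-popped r)

  at-intro : ∀ i {p} → address (state i) ≡ p → τ ⊩[ i ] at p
  at-intro i {p} eq = ≐-intro (line p) ref (trans (cong (value i) (meaning-line p))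
    (cong (λ b → if b then 0 else 1) (dec-true (address (state i) ≟ p) eq)))

  at-elim : ∀ i p → τ ⊩[ i ] at p → address (state i) ≡ p
  at-elim i p at-p = decidable-stable (address (state i) ≟ p) λ ne →
    0≢1+n (trans (sym (≐-elim (line p) ref at-p)) (trans (cong (value i) (meaning-line p))
      (cong (λ b → if b then 0 else 1) (dec-false (address (state i) ≟ p) ne))))

  marked-intro : τ ⊩[ n ] marked
  marked-intro = ≐-intro ref mark {n} (sym (cong (λ b → if b then 0 else 1) (dec-true (n ≟ n) refl)))

  marked-elim : ∀ {i} → i ≢ n → ¬ (τ ⊩[ i ] marked)
  marked-elim {i} ne m = 0≢1+n (trans (≐-elim ref mark {i} m)
    (cong (λ b → if b then 0 else 1) (dec-false (i ≟ n) ne)))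

  changes-intro : ∀ b x {i} →
    τ (suc i) x ≡ (if b then suc (τ i x) else τ i x) → τ ⊩[ i ] changes b x
  changes-intro true  x eq p = 1+n≢n (sym (trans (unchanged-elim x p) eq))
  changes-intro false x eq   = unchanged-intro x (sym eq)

  goto-holds : ∀ {i p e} → action i (state i) ≡ (p , e) → τ ⊩[ i ] goto p e
  goto-holds {i} {p} {e} act = at-intro (suc i) (address-step act) ,
    ⋀-intro (width Q) _ λ r _ →
      changes-intro (pushes e r) (pushed r) (pushed-step r) ,
      changes-intro (pops e r) (popped r) (popped-step r)
    where
    pushed-step : ∀ r →
      τ (suc i) (pushed r) ≡ (if pushes e r then suc (τ i (pushed r)) else τ i (pushed r))
    pushed-step r rewrite meaning-pushed r | act = refl
    popped-step : ∀ r →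
      τ (suc i) (popped r) ≡ (if pops e r then suc (τ i (popped r)) else τ i (popped r))
    popped-step r rewrite meaning-popped r | act = refl

  rules-hold : ∀ i → n ≤ i → τ ⊩[ i ] rules
  rules-hold i n≤i = ⋀-intro (length Q) _ λ p _ → rule-holds p (fetch Q p) refl
    where
    act : ∀ p {I} → fetch Q p ≡ I → τ ⊩[ i ] at p → action i (state i) ≡ reaction I (state i)
    act p f at-p = trans (action-run (state i) n≤i)
      (cong (λ J → reaction J (state i)) (trans (cong (fetch Q) (at-elim i p at-p)) f))

    rule-holds : ∀ p I → fetch Q p ≡ I → τ ⊩[ i ] rule p I
    rule-holds p nothing        f = ⊤′-intro {i}
    rule-holds p (just (inc r)) f (at-p , ¬goto) = ¬goto (goto-holds {i} {suc p}
      (trans (act p f at-p) (cong (λ q → suc q , push r) (at-elim i p at-p))))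
    rule-holds p (just (dec r l)) f =
      (λ (at-p , eq , ¬goto) → ¬goto (goto-holds {i}
        (trans (act p f at-p) (reaction-zero (state i)
          (trans (sym (τ-pushed i r)) (trans (≐-elim (pushed r) (popped r) eq) (τ-popped i r))))))) ,
      (λ (at-p , ne , ¬goto) → ¬goto (goto-holds {i} {suc p}
        (trans (act p f at-p) (trans
          (reaction-suc (state i) λ e → ne (≐-intro (pushed r) (popped r)
            (trans (τ-pushed i r) (trans e (sym (τ-popped i r))))))
          (cong (λ q → suc q , pop r) (at-elim i p at-p))))))

  -- Past: the pushes start at 0 and are never below the pops, so they have passed through the
  -- current number of pops. Future: if the pops later exceed the current number of pushes, they
  -- must pass through it. In both cases the position found differs from the current one, since
  -- there the totals differ.
  queue-holds : ∀ r → τ ⊩[ 0 ] queue r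
  queue-holds r =
    never-intro (pushed r >XF pushed r) (λ i _ (lift (j , i<j , lt)) →
      <⇒≱ (subst₂ _<_ (τ-pushed j r) (τ-pushed i r) lt) (slow-≤ (ups-slow r) (≤⇒≤′ (<⇒≤ i<j)))) ,
    never-intro (popped r >XF popped r) (λ i _ (lift (j , i<j , lt)) →
      <⇒≱ (subst₂ _<_ (τ-popped j r) (τ-popped i r) lt) (slow-≤ (downs-slow r) (≤⇒≤′ (<⇒≤ i<j)))) ,
    never-intro (∼ popped r ≐ pushed r ∧ ∼ popped r ≈XF⁻¹ pushed r) (λ i _ → past i) ,
    never-intro (∼ pushed r ≐ popped r ∧ (∼ pushed r ≈XF popped r ∧ pushed r <XF popped r))
      (λ i _ → future i) ,
    ≐-intro (pushed r) (popped r) (trans (τ-pushed 0 r) (sym (τ-popped 0 r)))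
    where
    past : ∀ i → ¬ (τ ⊩[ i ] (∼ popped r ≐ pushed r ∧ ∼ popped r ≈XF⁻¹ pushed r))
    past i (ne , ¬past) with slow-attains (ups-slow r) (≤⇒≤′ (z≤n {i})) z≤n (downs≤ups i r)
    ... | k , _ , k≤i , eq
      with m≤n⇒m<n∨m≡n k≤i | trans (τ-popped i r) (trans (sym eq) (sym (τ-pushed k r)))
    ...   | inj₁ k<i  | e = ¬past (lift (k , k<i , e))
    ...   | inj₂ refl | e = ne (≐-intro (popped r) (pushed r) e)

    future : ∀ i →
      ¬ (τ ⊩[ i ] (∼ pushed r ≐ popped r ∧ (∼ pushed r ≈XF popped r ∧ pushed r <XF popped r)))
    future i (ne , ¬future , lift (j , i<j , lt))
      with slow-attains (downs-slow r) (≤⇒≤′ (<⇒≤ i<j)) (downs≤ups i r)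
             (<⇒≤ (subst₂ _<_ (τ-pushed i r) (τ-popped j r) lt))
    ... | k , i≤k , _ , eq
      with m≤n⇒m<n∨m≡n i≤k | trans (τ-pushed i r) (trans (sym eq) (sym (τ-popped k r)))
    ...   | inj₁ i<k  | e = ¬future (lift (k , i<k , e))
    ...   | inj₂ refl | e = ne (≐-intro (pushed r) (popped r) e)

  module _ (j : ℕ) (n≤j : n ≤ j) (stopped : fetch Q (address (state j)) ≡ nothing) where

    halted-holds : τ ⊩[ j ] halted
    halted-holds = ⋀-intro (length Q) _ λ p p<len at-p →
      <⇒≱ p<len (fetch-nothing⇒≥ Q p (trans (cong (fetch Q) (sym (at-elim j p at-p))) stopped))

    formula-holds : τ ⊩[ 0 ] halting ∧ input n
    formula-holds =
      (⋀-intro (width Q) queue (λ r _ → queue-holds r) ,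
       never-intro (∼ ref ≈X^[ 1 ] ref) (λ i _ ne → ne (lift refl)) ,
       n , z≤n ,
       (marked-intro , never-intro marked (λ i n<i → marked-elim (<⇒≢ n<i ∘ sym)) ,
        at-intro n (proj₁ (booted n ≤-refl)) ,
        j , n≤j , halted-holds , λ i n≤i _ → rules-hold i n≤i) ,
       λ i _ i<n → marked-elim (<⇒≢ i<n) , proj₂ (goto-holds {i} (action-boot (state i) i<n))) ,
      lift (≐-elim ref mark {n} marked-intro)

    stable : ∀ {i} → j ≤′ i → state i ≡ state j
    stable ≤′-refl = refl
    stable (≤′-step {i} j≤i) = trans (cong (λ a → apply a (state i)) act) (stable j≤i)
      where
      act : action i (state i) ≡ (address (state i) , idle)
      act = trans (action-run (state i) (≤-trans n≤j (≤′⇒≤ j≤i)))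
        (cong (λ I → reaction I (state i))
          (trans (cong (fetch Q ∘ address) (stable j≤i)) stopped))

    -- A total grows by at most one per position and not at all after `j`. The bound is `suc j`
    -- rather than `j` because the values of `mark` and of the lines can be 1 even if `j` is 0.
    bounded : ∀ i v → τ i v ≤ suc j
    bounded i v = bound (meaning v)
      where
      flag : ∀ b → (if b then 0 else 1) ≤ suc j
      flag true  = z≤n
      flag false = s≤s z≤n

      counter : (f : Snapshot → ℕ) → Slow (f ∘ state) → f (state 0) ≡ 0 → f (state i) ≤ suc j
      counter f slow f0 with ≤-total i j
      ... | inj₁ i≤j = m≤n⇒m≤1+n (≤-trans (slow-bound slow f0 i) i≤j)
      ... | inj₂ j≤i = m≤n⇒m≤1+n
        (subst (λ s → f s ≤ j) (sym (stable (≤⇒≤′ j≤i))) (slow-bound slow f0 j))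

      bound : ∀ m → value i m ≤ suc j
      bound isRef        = z≤n
      bound isMark       = flag (i ≡ᵇ n)
      bound (isLine p)   = flag (address (state i) ≡ᵇ p)
      bound (isPushed r) = counter (λ s → ups s r) (ups-slow r) refl
      bound (isPopped r) = counter (λ s → downs s r) (downs-slow r) refl

-- Ascending chains in an infinite order

module Chains {a ℓ} {D : Set a} {_≺_ : Rel D ℓ} (sto : IsStrictTotalOrder _≡_ _≺_) where

  open IsStrictTotalOrder sto using (compare)
    renaming (_≟_ to _≟ᴰ_; trans to ≺-trans; irrefl to ≺-irrefl)

  insert : D → List D → List D
  insert e [] = e ∷ []
  insert e (x ∷ xs) with compare e x
  ... | tri> _ _ _ = x ∷ insert e xs
  ... | _          = e ∷ x ∷ xs

  length-insert : ∀ e xs → length (insert e xs) ≡ suc (length xs)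
  length-insert e [] = refl
  length-insert e (x ∷ xs) with compare e x
  ... | tri< _ _ _ = refl
  ... | tri≈ _ _ _ = refl
  ... | tri> _ _ _ = cong suc (length-insert e xs)

  All-insert : ∀ {d e} xs → d ≺ e → All (d ≺_) xs → All (d ≺_) (insert e xs)
  All-insert [] d≺e [] = d≺e ∷ []
  All-insert {e = e} (x ∷ xs) d≺e (p ∷ ps) with compare e x
  ... | tri< _ _ _ = d≺e ∷ p ∷ ps
  ... | tri≈ _ _ _ = d≺e ∷ p ∷ ps
  ... | tri> _ _ _ = p ∷ All-insert xs d≺e ps

  insert-ascending : ∀ {e} xs → e ∉ xs → AllPairs _≺_ xs → AllPairs _≺_ (insert e xs)
  insert-ascending [] e∉ [] = [] ∷ []
  insert-ascending {e} (x ∷ xs) e∉ (p ∷ ps) with compare e x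
  ... | tri< lt _ _ = (lt ∷ All.map (≺-trans lt) p) ∷ p ∷ ps
  ... | tri≈ _ eq _ = contradiction (here eq) e∉
  ... | tri> _ _ gt = All-insert xs gt p ∷ insert-ascending xs (e∉ ∘ there) ps

  index-unique : ∀ {xs d} → AllPairs _≺_ xs → (p q : d ∈ xs) → index p ≡ index q
  index-unique (_ ∷ _)  (here _)     (here _)     = refl
  index-unique (a ∷ _)  (here refl)  (there q)    = contradiction (All.lookup a q) (≺-irrefl refl)
  index-unique (a ∷ _)  (there p)    (here refl)  = contradiction (All.lookup a p) (≺-irrefl refl)
  index-unique (_ ∷ ps) (there p)    (there q)    = cong Fin.suc (index-unique ps p q)

  index-∈-lookup : ∀ (xs : List D) i → index (∈-lookup {xs = xs} i) ≡ i
  index-∈-lookup (x ∷ xs) Fin.zero    = refl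
  index-∈-lookup (x ∷ xs) (Fin.suc i) = cong Fin.suc (index-∈-lookup xs i)

  -- If no element can be inserted into an ascending list of length `k`, every element of `D` lies
  -- in it, and its position there is a bijection with `Fin k`, which `Infinite` forbids. No element
  -- is exhibited, hence the double negation.
  ascending-chain : Infinite D → ∀ k → ¬ ¬ (∃[ xs ] length xs ≡ k × AllPairs _≺_ xs)
  ascending-chain inf zero    none = none ([] , refl , [])
  ascending-chain inf (suc k) none = ascending-chain inf k λ { (xs , refl , asc) →
    let all : ∀ d → d ∈ xs
        all d = decidable-stable (Any.any? (d ≟ᴰ_) xs) λ d∉ →
          none (insert d xs , length-insert d xs , insert-ascending xs d∉ asc)
    in inf (length xs , mk↔ₛ′ (λ d → index (all d)) (List.lookup xs)
         (λ i → trans (index-unique asc (all (List.lookup xs i)) (∈-lookup i)) (index-∈-lookup xs i))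
         (λ d → sym (lookup-index (all d)))) }

  nth : D → List D → ℕ → D
  nth d []       i       = d
  nth d (x ∷ xs) zero    = x
  nth d (x ∷ xs) (suc i) = nth d xs i

  All-nth : ∀ {p} {P : D → Set p} d {xs} → All P xs → ∀ {i} → i < length xs → P (nth d xs i)
  All-nth d (p ∷ ps) {zero}  _         = p
  All-nth d (p ∷ ps) {suc i} (s≤s i<l) = All-nth d ps i<l

  nth-mono : ∀ d {xs} → AllPairs _≺_ xs → ∀ {i j} → i < j → j < length xs → nth d xs i ≺ nth d xs j
  nth-mono d (p ∷ ps) {zero}  {suc j} _         (s≤s j<l) = All-nth d p j<l
  nth-mono d (p ∷ ps) {suc i} {suc j} (s≤s i<j) (s≤s j<l) = nth-mono d ps i<j j<l

-- Transfer of a bounded model to `D`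

module Transfer {a ℓ} {D : Set a} {_≺_ : Rel D ℓ} (sto : IsStrictTotalOrder _≡_ _≺_)
  (d : ℕ → D) (bound : ℕ) (d-mono : ∀ i j → i < j → j ≤ bound → d i ≺ d j)
  (τ : Model ℕ) (bounded : ∀ i v → τ i v ≤ bound) where

  open IsStrictTotalOrder sto using () renaming (irrefl to ≺-irrefl; asym to ≺-asym)

  σ : Model D
  σ i v = d (τ i v)

  reflects-≡ : ∀ {m n} → m ≤ bound → n ≤ bound → d m ≡ d n → m ≡ n
  reflects-≡ {m} {n} m≤ n≤ eq with <-cmp m n
  ... | tri< lt _ _ = contradiction (d-mono m n lt n≤) (≺-irrefl eq)
  ... | tri≈ _ e _  = e
  ... | tri> _ _ gt = contradiction (d-mono n m gt m≤) (≺-irrefl (sym eq))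

  reflects-≺ : ∀ {m n} → m ≤ bound → n ≤ bound → d m ≺ d n → m < n
  reflects-≺ {m} {n} m≤ n≤ lt with <-cmp m n
  ... | tri< m<n _ _  = m<n
  ... | tri≈ _ refl _ = contradiction lt (≺-irrefl refl)
  ... | tri> _ _ n<m  = contradiction lt (≺-asym (d-mono n m n<m m≤))

  mutual

    -- Up to `bound`, `d` is an order embedding, so atoms are both preserved and reflected. Negation
    -- exchanges the two directions, hence the mutual induction.
    preserve : ∀ φ {i} → Semantics._,_⊨⊤_ _<_ τ i φ → Semantics._,_⊨⊤_ _≺_ σ i φ
    preserve (x ≈X^[ k ] y) (lift eq) = lift (cong d eq)
    preserve (x ≈XF y)   (lift (j , i<j , eq)) = lift (j , i<j , cong d eq)
    preserve (x ≈XF⁻¹ y) (lift (j , j<i , eq)) = lift (j , j<i , cong d eq)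
    preserve (x <XF y)   (lift (j , i<j , lt)) = lift (j , i<j , d-mono _ _ lt (bounded j y))
    preserve (x >XF y) {i} (lift (j , i<j , lt)) = lift (j , i<j , d-mono _ _ lt (bounded i x))
    preserve (φ ∧ ψ) (p , q) = preserve φ p , preserve ψ q
    preserve (∼ φ) ¬p p = ¬p (reflect φ p)
    preserve (X φ) p = preserve φ p
    preserve (φ U ψ) (j , i≤j , q , p) =
      j , i≤j , preserve ψ q , λ k i≤k k<j → preserve φ (p k i≤k k<j)

    reflect : ∀ φ {i} → Semantics._,_⊨⊤_ _≺_ σ i φ → Semantics._,_⊨⊤_ _<_ τ i φ
    reflect (x ≈X^[ k ] y) {i} (lift eq) = lift (reflects-≡ (bounded i x) (bounded (i + k) y) eq)
    reflect (x ≈XF y)   {i} (lift (j , i<j , eq)) =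
      lift (j , i<j , reflects-≡ (bounded i x) (bounded j y) eq)
    reflect (x ≈XF⁻¹ y) {i} (lift (j , j<i , eq)) =
      lift (j , j<i , reflects-≡ (bounded i x) (bounded j y) eq)
    reflect (x <XF y)   {i} (lift (j , i<j , lt)) =
      lift (j , i<j , reflects-≺ (bounded i x) (bounded j y) lt)
    reflect (x >XF y)   {i} (lift (j , i<j , lt)) =
      lift (j , i<j , reflects-≺ (bounded j y) (bounded i x) lt)
    reflect (φ ∧ ψ) (p , q) = reflect φ p , reflect ψ q
    reflect (∼ φ) ¬p p = ¬p (preserve φ p)
    reflect (X φ) p = reflect φ p
    reflect (φ U ψ) (j , i≤j , q , p) =
      j , i≤j , reflect ψ q , λ k i≤k k<j → reflect φ (p k i≤k k<j)

-- Embedding the smaller logic into the larger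

true′ : LRC
true′ = ∼ (0 <XF 0 ∧ ∼ 0 <XF 0)

embed : LRC⊤ → LRC
embed (x ≈X^[ i ] y) = x ≈X^[ i ] y
embed (x ≈XF y)      = x ≈⟨ true′ ?⟩ y
embed (x ≈XF⁻¹ y)    = x ≈⟨ true′ ?⟩⁻¹ y
embed (x <XF y)      = x <XF y
embed (x >XF y)      = x >XF y
embed (φ ∧ ψ)        = embed φ ∧ embed ψ
embed (∼ φ)          = ∼ embed φ
embed (X φ)          = X embed φ
embed (φ U ψ)        = embed φ U embed ψ

module Embed {a ℓ} {D : Set a} (_≺_ : Rel D ℓ) (σ : Model D) where

  open Semantics _≺_ renaming (_,_⊨⊤_ to infix 3 _⊩⊤[_]_; _,_⊨_ to infix 3 _⊩[_]_)

  true′-intro : ∀ {i} → σ ⊩[ i ] true′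
  true′-intro (p , ¬p) = ¬p p

  mutual

    to : ∀ φ {i} → σ ⊩⊤[ i ] φ → σ ⊩[ i ] embed φ
    to (x ≈X^[ k ] y) p = p
    to (x ≈XF y)   (lift (j , i<j , eq)) = j , i<j , eq , true′-intro {j}
    to (x ≈XF⁻¹ y) (lift (j , j<i , eq)) = j , j<i , eq , true′-intro {j}
    to (x <XF y) p = p
    to (x >XF y) p = p
    to (φ ∧ ψ) (p , q) = to φ p , to ψ q
    to (∼ φ) ¬p p = ¬p (from φ p)
    to (X φ) p = to φ p
    to (φ U ψ) (j , i≤j , q , p) =
      j , i≤j , to ψ q , λ k i≤k k<j → to φ (p k i≤k k<j)

    from : ∀ φ {i} → σ ⊩[ i ] embed φ → σ ⊩⊤[ i ] φ
    from (x ≈X^[ k ] y) p = p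
    from (x ≈XF y)   (j , i<j , eq , _) = lift (j , i<j , eq)
    from (x ≈XF⁻¹ y) (j , j<i , eq , _) = lift (j , j<i , eq)
    from (x <XF y) p = p
    from (x >XF y) p = p
    from (φ ∧ ψ) (p , q) = from φ p , from ψ q
    from (∼ φ) ¬p p = ¬p (to φ p)
    from (X φ) p = from φ p
    from (φ U ψ) (j , i≤j , q , p) =
      j , i≤j , from ψ q , λ k i≤k k<j → from φ (p k i≤k k<j)

-- The reduction and undecidability

module Reduction {a ℓ} {D : Set a} {_≺_ : Rel D ℓ} (sto : IsStrictTotalOrder _≡_ _≺_)
  (infinite : Infinite D) (Q : Machine) (n : ℕ) where

  open Formula Q
  open Completeness Q n
  open Chains sto

  sound : Satisfiable⊤ _≺_ (halting ∧ input n) → ¬ ¬ Halts Q (initial n)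
  sound (σ , h) = Soundness.halts sto Q n σ h

  complete : Halts Q (initial n) → ¬ ¬ Satisfiable⊤ _≺_ (halting ∧ input n)
  complete (_ , run) ¬sat
    with reaches-halt ≤-refl (proj₁ (booted n ≤-refl)) (proj₂ (booted n ≤-refl)) run
  -- The model takes values from 0 to `suc j`, which need `2 + j` data values. The chain is
  -- therefore nonempty, and its head serves as the default of `nth`.
  ... | j , n≤j , stopped = ascending-chain infinite (2 + j) λ where
    (x ∷ xs , len , asc) →
      let open Transfer sto (nth x (x ∷ xs)) (suc j)
            (λ i k i<k k≤j → nth-mono x asc i<k (subst (k <_) (sym len) (s≤s k≤j)))
            τ (bounded j n≤j stopped)
      in ¬sat (σ , preserve (halting ∧ input n) (formula-holds j n≤j stopped))

theorem3p1p1 : ∀ {a ℓ} {D : Set a} {_≺_ : Rel D ℓ} → IsStrictTotalOrder _≡_ _≺_ → Infinite D →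
    Undecidable gödel (Satisfiable _≺_) × Undecidable gödel⊤ (Satisfiable⊤ _≺_)
theorem3p1p1 {_≺_ = _≺_} sto infinite =
  diagonalisation-tree tree (Satisfiable _≺_)
    -- Both codings use tag 5 for `∧` and tag 0 for `≈X^`, so the same diagonal function serves both
    -- logics. Applied to an embedded `halting`, the conjunction is by computation
    -- `embed (halting ∧ input n)`, so satisfiability carries over in both directions.
    (embed ∘ Formula.halting) (λ φ n → φ ∧ ref ≈X^[ n ] mark) (leaf 5) (leaf 0) 1 (λ φ n → refl)
    (λ { Q n (σ , h) → R.sound Q n (σ , Embed.from _≺_ σ (Formula.halting Q ∧ input n) h) })
    (λ Q n h ¬sat → R.complete Q n h λ (σ , p) →
      ¬sat (σ , Embed.to _≺_ σ (Formula.halting Q ∧ input n) p)) ,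
  diagonalisation-tree tree⊤ (Satisfiable⊤ _≺_)
    Formula.halting (λ φ n → φ ∧ input n) (leaf 5) (leaf 0) 1 (λ φ n → refl) R.sound R.complete
  where module R = Reduction sto infinite
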